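{- For integers $K\ge0$ and $\nu\ge1$ let \[ \widetilde H_K(\nu):=\sum_{K\ge k_1>\cdots>k_\nu\ge1}\frac{1}{(2k_1+1)^2\cdots(2k_\nu+1)^2} \] (an empty sum, e.g. when $\nu>K$, being $0$), and $\widetilde H_K(0):=1$. Then for any integer $\mu\ge0$, \[ \big(1-4^{ -\mu-1}\big)\zeta(2\mu+2)=1+\sum_{k=1}^\infty\frac{(-1)^{k+\mu-1}}{16^k(2k+1)^2}\binom{2k}{k}\Big(\frac{10k^3+9k^2-k+1}{2k-1}\widetilde H_{k-1}(\mu)+4k(k+1)\sum_{j=1}^{\mu}\frac{(-1)^j}{(2k+1)^{2j}}\widetilde H_{k-1}(\mu-j)\Big). \]
   Context: $\zeta$ is the Riemann zeta function. -}

module Defs where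

open import Data.Nat as ℕ using (ℕ; zero; suc)
open import Data.Nat.Combinatorics using (_C_)
open import Data.Integer using (+_)
open import Data.Rational using (ℚ; 0ℚ; 1ℚ; _+_; _*_; _-_; -_; _/_)

ℕ→ℚ : ℕ → ℚ
ℕ→ℚ n = + n / 1

-- reciprocal of a natural number (only ever applied to positive arguments;
-- the value at 0 is an irrelevant junk value 0)
inv : ℕ → ℚ
inv zero    = 0ℚ
inv (suc n) = + 1 / suc n

sgn : ℕ → ℚ
sgn zero    = 1ℚ
sgn (suc m) = - sgn m

sumTo : ℕ → (ℕ → ℚ) → ℚ
sumTo zero    f = 0ℚ
sumTo (suc n) f = sumTo n f + f (suc n)

-- H̃_K(ν) = Σ_{K ≥ k₁ > ⋯ > k_ν ≥ 1} 1/((2k₁+1)² ⋯ (2k_ν+1)²),  H̃_K(0) = 1.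
-- Written by summing over the outermost index k₁ = k ∈ {1..K}; the remaining
-- indices range over k-1 ≥ k₂ > ⋯ > k_ν ≥ 1.  Empty sums are 0.
Ht : ℕ → ℕ → ℚ
Ht K zero    = 1ℚ
Ht K (suc ν) = sumTo K (λ k → inv ((2 ℕ.* k ℕ.+ 1) ℕ.^ 2) * Ht (k ℕ.∸ 1) ν)

term : ℕ → ℕ → ℚ
term μ k =
  sgn (k ℕ.+ μ ℕ.∸ 1) * inv (16 ℕ.^ k ℕ.* (2 ℕ.* k ℕ.+ 1) ℕ.^ 2) * ℕ→ℚ ((2 ℕ.* k) C k)
  * ( (ℕ→ℚ (10 ℕ.* k ℕ.^ 3 ℕ.+ 9 ℕ.* k ℕ.^ 2 ℕ.+ 1) - ℕ→ℚ k) * inv (2 ℕ.* k ℕ.∸ 1) * Ht (k ℕ.∸ 1) μ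
    + ℕ→ℚ (4 ℕ.* k ℕ.* (k ℕ.+ 1))
      * sumTo μ (λ j → sgn j * inv ((2 ℕ.* k ℕ.+ 1) ℕ.^ (2 ℕ.* j)) * Ht (k ℕ.∸ 1) (μ ℕ.∸ j)) )

rhsPartial : ℕ → ℕ → ℚ
rhsPartial μ N = 1ℚ + sumTo N (term μ)

zetaPartial : ℕ → ℕ → ℚ
zetaPartial s N = sumTo N (λ n → inv (n ℕ.^ s))

lhsPartial : ℕ → ℕ → ℚ
lhsPartial μ N = (1ℚ - inv (4 ℕ.^ (μ ℕ.+ 1))) * zetaPartial (2 ℕ.* μ ℕ.+ 2) N

{-# OPTIONS --safe #-}
module Submission where

-- Take generating functions in a (with coefficient index μ), and put b_k = (2k+1)²,
-- q_k = b_k − a and A_k = (−1)ᵏ 16⁻ᵏ C(2k,k) Π_{m<k} q_m/b_m.  For every N,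
--   1/q_N = Σ_{k<N} T_k/(b_N − b_k) + T_N/q_N   with   T_k = Π_{m<k} (a − b_m)/(b_N − b_m),
-- and T_k is A_k times the rational number σ k (N − k).  For fixed k the sum of
-- T_k/(b_N − b_k) over N telescopes, so summing over N gives
--   Σ_{n≤N} 1/q_n = Σ_{k≤N} A_k (1/q_k + 1/(4 b_k)) − E_N,
-- where E_N is O(1/N) coefficientwise.  For k ≥ 1 the k-th summand on the right minus the
-- k-th term of the series in question is itself a difference V_k − V_{k−1}, with V_k = O(2⁻ᵏ).
-- Finally Σ_{n≤N} (2n+1)⁻ˢ differs from (1 − 2⁻ˢ) Σ_{n≤N} n⁻ˢ by Σ_{N<n≤2N+1} n⁻ˢ ≤ 1/(N+1).

open import Defs
open import Data.Nat using (ℕ; _≥_)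
open import Data.Product using (Σ)
open import Data.Rational using (ℚ; 0ℚ; _<_; _-_; ∣_∣)

open import Data.Nat as ℕ using (zero; suc; NonZero; z≤n; s≤s; _!)
import Data.Nat.Properties as ℕ
open import Data.Nat.Combinatorics using (_C_; nCk≡n!/k![n-k]!; k![n∸k]!∣n!)
open import Data.Nat.Divisibility using (_∣_; ∣⇒≤)
open import Data.Nat.DivMod using (m/n*n≡m)
open import Data.Nat.Solver using () renaming (module +-*-Solver to S)
open import Data.Integer as ℤ using (+_)
import Data.Integer.Properties as ℤ
open import Data.Product using (∃; _,_)
open import Data.Rational using (mkℚ; 1ℚ; _+_; _*_; -_; _/_; _≤_; *<*; nonNegative; toℚᵘ)
open import Data.Rational.Properties
open import Data.Rational.Solver using (module +-*-Solver)
open import Data.Rational.Unnormalised as ℚᵘ using (mkℚᵘ; *≡*; *≤*; *<*)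
import Data.Rational.Unnormalised.Properties as ℚᵘ
open import Relation.Binary.PropositionalEquality
open import Function using (_∘_)
open +-*-Solver using (solve; _:=_; con; _:+_; _:*_; _:-_; :-_)

-- Natural numbers and their reciprocals in ℚ.

-- `_/_` normalises its fraction; passing to unnormalised rationals through this equivalence turns
-- each fact about `ℕ→ℚ` and `inv` into a cross-multiplied statement about integers.
toℚᵘ-/ : ∀ z d → toℚᵘ (z / suc d) ℚᵘ.≃ mkℚᵘ z d
toℚᵘ-/ z d = toℚᵘ-fromℚᵘ (mkℚᵘ z d)

ℕ→ℚ-+ : ∀ m n → ℕ→ℚ (m ℕ.+ n) ≡ ℕ→ℚ m + ℕ→ℚ n
ℕ→ℚ-+ m n = toℚᵘ-injective (begin
  toℚᵘ (ℕ→ℚ (m ℕ.+ n))              ≈⟨ toℚᵘ-/ _ 0 ⟩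
  mkℚᵘ (+ (m ℕ.+ n)) 0              ≈⟨ *≡* (cong (ℤ._* (+ 1)) (sym (cong₂ ℤ._+_ (ℤ.*-identityʳ (+ m)) (ℤ.*-identityʳ (+ n))))) ⟩
  mkℚᵘ (+ m) 0 ℚᵘ.+ mkℚᵘ (+ n) 0    ≈⟨ ℚᵘ.+-cong (toℚᵘ-/ (+ m) 0) (toℚᵘ-/ (+ n) 0) ⟨
  toℚᵘ (ℕ→ℚ m) ℚᵘ.+ toℚᵘ (ℕ→ℚ n)    ≈⟨ toℚᵘ-homo-+ (ℕ→ℚ m) (ℕ→ℚ n) ⟨
  toℚᵘ (ℕ→ℚ m + ℕ→ℚ n)              ∎)
  where open ℚᵘ.≃-Reasoning

ℕ→ℚ-* : ∀ m n → ℕ→ℚ (m ℕ.* n) ≡ ℕ→ℚ m * ℕ→ℚ n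
ℕ→ℚ-* m n = toℚᵘ-injective (begin
  toℚᵘ (ℕ→ℚ (m ℕ.* n))              ≈⟨ toℚᵘ-/ _ 0 ⟩
  mkℚᵘ (+ (m ℕ.* n)) 0              ≈⟨ *≡* (cong (ℤ._* (+ 1)) (ℤ.pos-* m n)) ⟩
  mkℚᵘ (+ m) 0 ℚᵘ.* mkℚᵘ (+ n) 0    ≈⟨ ℚᵘ.*-cong (toℚᵘ-/ (+ m) 0) (toℚᵘ-/ (+ n) 0) ⟨
  toℚᵘ (ℕ→ℚ m) ℚᵘ.* toℚᵘ (ℕ→ℚ n)    ≈⟨ toℚᵘ-homo-* (ℕ→ℚ m) (ℕ→ℚ n) ⟨
  toℚᵘ (ℕ→ℚ m * ℕ→ℚ n)              ∎)
  where open ℚᵘ.≃-Reasoning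

ℕ→ℚ-mono-≤ : ∀ {m n} → m ℕ.≤ n → ℕ→ℚ m ≤ ℕ→ℚ n
ℕ→ℚ-mono-≤ {m} {n} m≤n = toℚᵘ-cancel-≤ (begin
  toℚᵘ (ℕ→ℚ m)  ≃⟨ toℚᵘ-/ _ 0 ⟩
  mkℚᵘ (+ m) 0  ≤⟨ *≤* (ℤ.*-monoʳ-≤-nonNeg (+ 1) (ℤ.+≤+ m≤n)) ⟩
  mkℚᵘ (+ n) 0  ≃⟨ toℚᵘ-/ _ 0 ⟨
  toℚᵘ (ℕ→ℚ n)  ∎)
  where open ℚᵘ.≤-Reasoning

0≤ℕ→ℚ : ∀ n → 0ℚ ≤ ℕ→ℚ n
0≤ℕ→ℚ n = ℕ→ℚ-mono-≤ {0} {n} z≤n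

inv-inverseʳ : ∀ n .{{_ : NonZero n}} → ℕ→ℚ n * inv n ≡ 1ℚ
inv-inverseʳ (suc n) = toℚᵘ-injective (begin
  toℚᵘ (ℕ→ℚ (suc n) * inv (suc n))             ≈⟨ toℚᵘ-homo-* (ℕ→ℚ (suc n)) (inv (suc n)) ⟩
  toℚᵘ (ℕ→ℚ (suc n)) ℚᵘ.* toℚᵘ (inv (suc n))   ≈⟨ ℚᵘ.*-cong (toℚᵘ-/ (+ suc n) 0) (toℚᵘ-/ (+ 1) n) ⟩
  mkℚᵘ (+ suc n) 0 ℚᵘ.* mkℚᵘ (+ 1) n           ≈⟨ *≡* (trans (ℤ.*-identityʳ _) (trans (ℤ.*-identityʳ (+ suc n)) (sym (trans (ℤ.*-identityˡ _) (cong (λ z → + suc z) (ℕ.+-identityʳ n)))))) ⟩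
  toℚᵘ 1ℚ                                      ∎)
  where open ℚᵘ.≃-Reasoning

inverse-unique : ∀ {p q r} → p * q ≡ 1ℚ → p * r ≡ 1ℚ → q ≡ r
inverse-unique {p} {q} {r} pq pr = begin
  q            ≡⟨ *-identityʳ q ⟨
  q * 1ℚ       ≡⟨ cong (q *_) pr ⟨
  q * (p * r)  ≡⟨ solve 3 (λ p q r → q :* (p :* r) := (p :* q) :* r) refl p q r ⟩
  (p * q) * r  ≡⟨ cong (_* r) pq ⟩
  1ℚ * r       ≡⟨ *-identityˡ r ⟩
  r            ∎
  where open ≡-Reasoning

-- The value 0 of `inv 0` is itself compatible with products, which settles the first two clauses;
-- for positive arguments both sides invert the same rational.
inv-* : ∀ m n → inv (m ℕ.* n) ≡ inv m * inv n
inv-* zero    n       = sym (*-zeroˡ (inv n))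
inv-* (suc m) zero    = trans (cong inv (ℕ.*-zeroʳ m)) (sym (*-zeroʳ (inv (suc m))))
inv-* (suc m) (suc n) = inverse-unique {ℕ→ℚ (suc m ℕ.* suc n)} (inv-inverseʳ (suc m ℕ.* suc n)) (begin
  ℕ→ℚ (suc m ℕ.* suc n) * (u * v)   ≡⟨ cong (_* (u * v)) (ℕ→ℚ-* (suc m) (suc n)) ⟩
  (x * y) * (u * v)                 ≡⟨ solve 4 (λ x y u v → (x :* y) :* (u :* v) := (x :* u) :* (y :* v)) refl x y u v ⟩
  (x * u) * (y * v)                 ≡⟨ cong₂ _*_ (inv-inverseʳ (suc m)) (inv-inverseʳ (suc n)) ⟩
  1ℚ                                ∎)
  where
  open ≡-Reasoning
  x = ℕ→ℚ (suc m); y = ℕ→ℚ (suc n); u = inv (suc m); v = inv (suc n)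

inv-antimono-≤ : ∀ {m n} .{{_ : NonZero m}} → m ℕ.≤ n → inv n ≤ inv m
inv-antimono-≤ {suc m} {suc n} m≤n = toℚᵘ-cancel-≤ (begin
  toℚᵘ (inv (suc n))  ≃⟨ toℚᵘ-/ (+ 1) n ⟩
  mkℚᵘ (+ 1) n        ≤⟨ *≤* (ℤ.*-monoˡ-≤-nonNeg (+ 1) (ℤ.+≤+ m≤n)) ⟩
  mkℚᵘ (+ 1) m        ≃⟨ toℚᵘ-/ (+ 1) m ⟨
  toℚᵘ (inv (suc m))  ∎)
  where open ℚᵘ.≤-Reasoning

0≤inv : ∀ n → 0ℚ ≤ inv n
0≤inv zero    = ≤-refl
0≤inv (suc n) = toℚᵘ-cancel-≤ (begin
  toℚᵘ 0ℚ             ≤⟨ *≤* (ℤ.+≤+ z≤n) ⟩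
  mkℚᵘ (+ 1) n        ≃⟨ toℚᵘ-/ (+ 1) n ⟨
  toℚᵘ (inv (suc n))  ∎)
  where open ℚᵘ.≤-Reasoning

inv≤1 : ∀ n → inv n ≤ 1ℚ
inv≤1 zero    = 0≤ℕ→ℚ 1
inv≤1 (suc n) = inv-antimono-≤ {1} {suc n} (s≤s z≤n)

2ℚ 4ℚ 8ℚ : ℚ
2ℚ = ℕ→ℚ 2
4ℚ = ℕ→ℚ 4
8ℚ = ℕ→ℚ 8

*-difference≡0 : ∀ {l r} c → l ≡ r → c * (l - r) ≡ 0ℚ
*-difference≡0 {l} c refl = solve 2 (λ l c → c :* (l :- l) := con 0ℚ) refl l c

-- Polynomial identities modulo hypotheses l ≡ r, with explicit cofactors for the ring solver.
linear-combination₁ : ∀ {p q l r} c → l ≡ r → p ≡ q + c * (l - r) → p ≡ q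
linear-combination₁ {q = q} c e h = trans h (trans (cong (λ z → q + z) (*-difference≡0 c e)) (+-identityʳ q))

linear-combination₂ : ∀ {p q l r l′ r′} c c′ → l ≡ r → l′ ≡ r′ →
                      p ≡ q + c * (l - r) + c′ * (l′ - r′) → p ≡ q
linear-combination₂ c c′ e e′ h = linear-combination₁ c e (linear-combination₁ c′ e′ h)

-- Odd numbers and central binomial coefficients.

odd : ℕ → ℕ
odd k = 2 ℕ.* k ℕ.+ 1

odd≡suc : ∀ k → odd k ≡ suc (2 ℕ.* k)
odd≡suc k = ℕ.+-comm (2 ℕ.* k) 1

odd≢0 : ∀ k → NonZero (odd k)
odd≢0 k rewrite odd≡suc k = _

ℕ→ℚ-odd : ∀ k → ℕ→ℚ (odd k) ≡ 2ℚ * ℕ→ℚ k + 1ℚ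
ℕ→ℚ-odd k = trans (ℕ→ℚ-+ (2 ℕ.* k) 1) (cong (_+ 1ℚ) (ℕ→ℚ-* 2 k))

odd-inverse : ∀ k → (2ℚ * ℕ→ℚ k + 1ℚ) * inv (odd k) ≡ 1ℚ
odd-inverse k = trans (cong (_* inv (odd k)) (sym (ℕ→ℚ-odd k))) (inv-inverseʳ (odd k) {{odd≢0 k}})

suc-inverse : ∀ k → (1ℚ + ℕ→ℚ k) * inv (suc k) ≡ 1ℚ
suc-inverse k = trans (cong (_* inv (suc k)) (sym (ℕ→ℚ-+ 1 k))) (inv-inverseʳ (suc k))

inv-odd² : ∀ k → inv (odd k ℕ.^ 2) ≡ inv (odd k) * inv (odd k)
inv-odd² k = trans (inv-* (odd k) (odd k ℕ.* 1)) (cong (λ n → inv (odd k) * inv n) (ℕ.*-identityʳ (odd k)))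

2*n∸n≡n : ∀ n → 2 ℕ.* n ℕ.∸ n ≡ n
2*n∸n≡n n = trans (ℕ.m+n∸m≡n n (n ℕ.+ 0)) (ℕ.+-identityʳ n)

centralBinomial-! : ∀ n → ((2 ℕ.* n) C n) ℕ.* (n ! ℕ.* n !) ≡ (2 ℕ.* n) !
centralBinomial-! n = begin
  ((2 ℕ.* n) C n) ℕ.* (n ! ℕ.* n !)                         ≡⟨ cong (λ m → ((2 ℕ.* n) C n) ℕ.* (n ! ℕ.* m !)) (2*n∸n≡n n) ⟨
  ((2 ℕ.* n) C n) ℕ.* (n ! ℕ.* (2 ℕ.* n ℕ.∸ n) !)           ≡⟨ cong (ℕ._* (n ! ℕ.* (2 ℕ.* n ℕ.∸ n) !)) (nCk≡n!/k![n-k]! n≤2n) ⟩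
  ((2 ℕ.* n) ! ℕ./ (n ! ℕ.* (2 ℕ.* n ℕ.∸ n) !)) ℕ.* (n ! ℕ.* (2 ℕ.* n ℕ.∸ n) !)  ≡⟨ m/n*n≡m (k![n∸k]!∣n! n≤2n) ⟩
  (2 ℕ.* n) !                                             ∎
  where
  open ≡-Reasoning
  n≤2n : n ℕ.≤ 2 ℕ.* n
  n≤2n = ℕ.m≤m+n n (n ℕ.+ 0)
  instance
    _ = ℕ._!*_!≢0 n (2 ℕ.* n ℕ.∸ n)

-- Multiplied by (n+1) n!², both sides become (2n+2)!.
centralBinomial-suc : ∀ n → ((2 ℕ.* suc n) C suc n) ℕ.* suc n ≡ 2 ℕ.* odd n ℕ.* ((2 ℕ.* n) C n)
centralBinomial-suc n = ℕ.*-cancelʳ-≡ _ _ (suc n ℕ.* (n ! ℕ.* n !)) (begin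
  c′ ℕ.* suc n ℕ.* (suc n ℕ.* (f ℕ.* f))          ≡⟨ S.solve 3 (λ c s f → c S.:* s S.:* (s S.:* (f S.:* f)) S.:= c S.:* ((s S.:* f) S.:* (s S.:* f))) refl c′ (suc n) f ⟩
  c′ ℕ.* (suc n ! ℕ.* suc n !)                    ≡⟨ centralBinomial-! (suc n) ⟩
  (2 ℕ.* suc n) !                                 ≡⟨ cong _! (ℕ.*-suc 2 n) ⟩
  suc (suc t) ℕ.* (suc t ℕ.* t !)                 ≡⟨ cong (λ z → suc (suc t) ℕ.* (suc t ℕ.* z)) (centralBinomial-! n) ⟨
  suc (suc t) ℕ.* (suc t ℕ.* (c ℕ.* (f ℕ.* f)))   ≡⟨ S.solve 3 (λ n c f → (S.con 2 S.:+ S.con 2 S.:* n) S.:* ((S.con 1 S.:+ S.con 2 S.:* n) S.:* (c S.:* (f S.:* f))) S.:= S.con 2 S.:* (S.con 2 S.:* n S.:+ S.con 1) S.:* c S.:* ((S.con 1 S.:+ n) S.:* (f S.:* f))) refl n c f ⟩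
  2 ℕ.* odd n ℕ.* c ℕ.* (suc n ℕ.* (f ℕ.* f))     ∎)
  where
  open ≡-Reasoning
  f = n !
  t = 2 ℕ.* n
  c = (2 ℕ.* n) C n
  c′ = (2 ℕ.* suc n) C suc n
  instance
    _ : NonZero (suc n ℕ.* (f ℕ.* f))
    _ = ℕ.m*n≢0 (suc n) (f ℕ.* f) {{_}} {{ℕ._!*_!≢0 n n}}

centralCoeff : ℕ → ℚ
centralCoeff k = inv (16 ℕ.^ k) * ℕ→ℚ ((2 ℕ.* k) C k)

ratio : ℕ → ℚ
ratio k = ℕ→ℚ (odd k) * inv (8 ℕ.* suc k)

centralCoeff-suc : ∀ k → centralCoeff (suc k) ≡ ratio k * centralCoeff k
centralCoeff-suc k = begin
  inv (16 ℕ.* 16 ℕ.^ k) * c′                   ≡⟨ cong (_* c′) (inv-* 16 (16 ℕ.^ k)) ⟩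
  inv 16 * h * c′                              ≡⟨ algebra h c c′ x m binom (suc-inverse k) ⟩
  (2ℚ * x + 1ℚ) * (inv 8 * m) * (h * c)        ≡⟨ cong₂ (λ u v → u * v * (h * c)) (sym (ℕ→ℚ-odd k)) (sym (inv-* 8 (suc k))) ⟩
  ratio k * (h * c)                            ∎
  where
  open ≡-Reasoning
  h = inv (16 ℕ.^ k)
  c = ℕ→ℚ ((2 ℕ.* k) C k)
  c′ = ℕ→ℚ ((2 ℕ.* suc k) C suc k)
  x = ℕ→ℚ k
  m = inv (suc k)
  binom : c′ * (1ℚ + x) ≡ 2ℚ * (2ℚ * x + 1ℚ) * c
  binom = begin
    c′ * (1ℚ + x)                                     ≡⟨ cong (c′ *_) (ℕ→ℚ-+ 1 k) ⟨
    c′ * ℕ→ℚ (suc k)                                  ≡⟨ ℕ→ℚ-* ((2 ℕ.* suc k) C suc k) (suc k) ⟨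
    ℕ→ℚ (((2 ℕ.* suc k) C suc k) ℕ.* suc k)             ≡⟨ cong ℕ→ℚ (centralBinomial-suc k) ⟩
    ℕ→ℚ (2 ℕ.* odd k ℕ.* ((2 ℕ.* k) C k))             ≡⟨ ℕ→ℚ-* (2 ℕ.* odd k) ((2 ℕ.* k) C k) ⟩
    ℕ→ℚ (2 ℕ.* odd k) * c                             ≡⟨ cong (_* c) (trans (ℕ→ℚ-* 2 (odd k)) (cong (2ℚ *_) (ℕ→ℚ-odd k))) ⟩
    2ℚ * (2ℚ * x + 1ℚ) * c                            ∎
  algebra : ∀ h c c′ x m → c′ * (1ℚ + x) ≡ 2ℚ * (2ℚ * x + 1ℚ) * c → (1ℚ + x) * m ≡ 1ℚ →
            inv 16 * h * c′ ≡ (2ℚ * x + 1ℚ) * (inv 8 * m) * (h * c)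
  algebra h c c′ x m e₁ e₂ = linear-combination₂ (inv 16 * h * m) (- (inv 16 * h * c′)) e₁ e₂
    (solve 5 (λ h c c′ x m → con (inv 16) :* h :* c′ :=
        (con 2ℚ :* x :+ con 1ℚ) :* (con (inv 8) :* m) :* (h :* c)
        :+ con (inv 16) :* h :* m :* (c′ :* (con 1ℚ :+ x) :- con 2ℚ :* (con 2ℚ :* x :+ con 1ℚ) :* c)
        :+ (:- (con (inv 16) :* h :* c′)) :* ((con 1ℚ :+ x) :* m :- con 1ℚ))
      refl h c c′ x m)

-- The products A_k and D as coefficient sequences in a.

-- Multiplication by a, on coefficient sequences.
shift : (ℕ → ℚ) → ℕ → ℚ
shift f zero    = 0ℚ
shift f (suc μ) = f μ

δ : ℕ → ℚ
δ zero    = 1ℚ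
δ (suc μ) = 0ℚ

β : ℕ → ℚ
β k = inv (odd k) * inv (odd k)

-- D i is the coefficient sequence of (−1)ᵏ 16⁻ᵏ C(2k,k) Π_{1≤m<k} q_m/b_m for k = i + 1,
-- so that A k = (1 − a) D i; H̃ omits the factor m = 0.
D : ℕ → ℕ → ℚ
D i μ = sgn (suc i ℕ.+ μ) * centralCoeff (suc i) * Ht i μ

D-zero : ∀ μ → D 0 μ ≡ - (inv 8 * δ μ)
D-zero zero    = refl
D-zero (suc μ) = *-zeroʳ (sgn (1 ℕ.+ suc μ) * centralCoeff 1)

-- The new factor is q_k/b_k = 1 - a/b_k with k = i + 1. On the side of `Ht` it corresponds to the
-- last summand of the outer sum, the one with k₁ = k, which unfolds definitionally.
D-suc : ∀ i μ → D (suc i) μ ≡ - (ratio (suc i) * (D i μ - β (suc i) * shift (D i) μ))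
D-suc i zero = begin
  - s * centralCoeff (2 ℕ.+ i) * 1ℚ              ≡⟨ cong (λ z → - s * z * 1ℚ) (centralCoeff-suc (suc i)) ⟩
  - s * (ratio (suc i) * c) * 1ℚ                 ≡⟨ solve 4 (λ s r c b → (:- s) :* (r :* c) :* con 1ℚ := :- (r :* (s :* c :* con 1ℚ :- b :* con 0ℚ))) refl s (ratio (suc i)) c (β (suc i)) ⟩
  - (ratio (suc i) * (s * c * 1ℚ - β (suc i) * 0ℚ)) ∎
  where
  open ≡-Reasoning
  s = sgn (suc i ℕ.+ 0)
  c = centralCoeff (suc i)
D-suc i (suc ν) = begin
  - sgn (suc i ℕ.+ suc ν) * centralCoeff (2 ℕ.+ i) * (H + inv (odd (suc i) ℕ.^ 2) * H′)
    ≡⟨ cong₂ (λ z b → - sgn (suc i ℕ.+ suc ν) * z * (H + b * H′)) (centralCoeff-suc (suc i)) (inv-odd² (suc i)) ⟩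
  - sgn (suc i ℕ.+ suc ν) * (r * c) * (H + b * H′)
    ≡⟨ cong (λ n → - sgn n * (r * c) * (H + b * H′)) (ℕ.+-suc (suc i) ν) ⟩
  - - s * (r * c) * (H + b * H′)
    ≡⟨ solve 6 (λ s r c b H H′ → (:- (:- s)) :* (r :* c) :* (H :+ b :* H′) := :- (r :* ((:- s) :* c :* H :- b :* (s :* c :* H′)))) refl s r c b H H′ ⟩
  - (r * (- s * c * H - b * D i ν))
    ≡⟨ cong (λ n → - (r * (sgn n * c * H - b * D i ν))) (ℕ.+-suc (suc i) ν) ⟨
  - (r * (D i (suc ν) - b * D i ν)) ∎
  where
  open ≡-Reasoning
  s = sgn (suc i ℕ.+ ν)
  c = centralCoeff (suc i)
  r = ratio (suc i)
  b = β (suc i)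
  H = Ht i (suc ν)
  H′ = Ht i ν

A : ℕ → ℕ → ℚ
A zero    μ = δ μ
A (suc i) μ = D i μ - shift (D i) μ

A-one : ∀ μ → A 1 μ ≡ inv 8 * (shift δ μ - δ μ)
A-one zero          = refl
A-one (suc zero)    = refl
A-one (suc (suc μ)) = trans (cong₂ _-_ (D-zero (2 ℕ.+ μ)) (D-zero (1 ℕ.+ μ))) refl

ratio-odd : ∀ k → ratio k * β k ≡ inv (8 ℕ.* suc k) * inv (odd k)
ratio-odd k = linear-combination₁ (inv (8 ℕ.* suc k) * inv (odd k)) (inv-inverseʳ (odd k) {{odd≢0 k}})
  (solve 3 (λ o m d → o :* m :* (d :* d) := m :* d :+ m :* d :* (o :* d :- con 1ℚ)) refl
     (ℕ→ℚ (odd k)) (inv (8 ℕ.* suc k)) (inv (odd k)))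

ℕ→ℚ-odd² : ∀ k → ℕ→ℚ (odd k) * ℕ→ℚ (odd k) * β k ≡ 1ℚ
ℕ→ℚ-odd² k = linear-combination₁ (1ℚ + o * d) (inv-inverseʳ (odd k) {{odd≢0 k}})
  (solve 2 (λ o d → o :* o :* (d :* d) := con 1ℚ :+ (con 1ℚ :+ o :* d) :* (o :* d :- con 1ℚ)) refl o d)
  where o = ℕ→ℚ (odd k); d = inv (odd k)

-- The factor -q_j/b_j is written as `β j` times a - b_j, the numerator of the next factor of T_k,
-- so that it can later be set against b_N - b_j. For j ≥ 1 it follows from `D-suc` at two
-- neighbouring coefficients; `A 0` is not built from `D`, hence the separate case j = 0.
A-suc : ∀ j μ → A (suc j) μ ≡ ratio j * β j * (shift (A j) μ - ℕ→ℚ (odd j) * ℕ→ℚ (odd j) * A j μ)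
A-suc zero    μ = trans (A-one μ) (solve 2 (λ s a → con (inv 8) :* (s :- a) := con (ratio 0 * β 0) :* (s :- con (ℕ→ℚ 1 * ℕ→ℚ 1) :* a)) refl (shift δ μ) (δ μ))
A-suc (suc i) zero = begin
  D (suc i) 0 - 0ℚ                        ≡⟨ cong (_- 0ℚ) (D-suc i 0) ⟩
  - (r * (D i 0 - b * 0ℚ)) - 0ℚ           ≡⟨ linear-combination₁ (r * D i 0) (ℕ→ℚ-odd² (suc i))
      (solve 4 (λ r b d o → :- (r :* (d :- b :* con 0ℚ)) :- con 0ℚ := r :* b :* (con 0ℚ :- o :* o :* (d :- con 0ℚ)) :+ r :* d :* (o :* o :* b :- con 1ℚ)) refl r b (D i 0) o) ⟩
  r * b * (0ℚ - o * o * (D i 0 - 0ℚ))     ∎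
  where
  open ≡-Reasoning
  r = ratio (suc i); b = β (suc i); o = ℕ→ℚ (odd (suc i))
A-suc (suc i) (suc ν) = begin
  D (suc i) (suc ν) - D (suc i) ν         ≡⟨ cong₂ _-_ (D-suc i (suc ν)) (D-suc i ν) ⟩
  - (r * (x - b * y)) - - (r * (y - b * z)) ≡⟨ linear-combination₁ (r * (x - y)) (ℕ→ℚ-odd² (suc i))
      (solve 6 (λ r b o x y z → :- (r :* (x :- b :* y)) :- (:- (r :* (y :- b :* z))) := r :* b :* (y :- z :- o :* o :* (x :- y)) :+ r :* (x :- y) :* (o :* o :* b :- con 1ℚ)) refl r b o x y z) ⟩
  r * b * (y - z - o * o * (x - y))       ∎
  where
  open ≡-Reasoning
  r = ratio (suc i); b = β (suc i); o = ℕ→ℚ (odd (suc i))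
  x = D i (suc ν); y = D i ν; z = shift (D i) ν

-- Finite sums, and the terms of the series expressed through `D` and `tail`.

sumTo-head : ∀ n f → sumTo (suc n) f ≡ f 1 + sumTo n (f ∘ suc)
sumTo-head zero    f = +-comm 0ℚ (f 1)
sumTo-head (suc n) f = trans (cong (_+ f (2 ℕ.+ n)) (sumTo-head n f)) (+-assoc (f 1) (sumTo n (f ∘ suc)) (f (2 ℕ.+ n)))

sumTo-cong : ∀ n {f g : ℕ → ℚ} → (∀ k → f k ≡ g k) → sumTo n f ≡ sumTo n g
sumTo-cong zero    e = refl
sumTo-cong (suc n) e = cong₂ _+_ (sumTo-cong n e) (e (suc n))

sumTo-*ˡ : ∀ n c f → sumTo n (λ k → c * f k) ≡ c * sumTo n f
sumTo-*ˡ zero    c f = sym (*-zeroʳ c)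
sumTo-*ˡ (suc n) c f = trans (cong (_+ c * f (suc n)) (sumTo-*ˡ n c f)) (sym (*-distribˡ-+ c (sumTo n f) (f (suc n))))

inv-odd-^ : ∀ k n → inv (odd k ℕ.^ (2 ℕ.+ n)) ≡ β k * inv (odd k ℕ.^ n)
inv-odd-^ k n = begin
  inv (odd k ℕ.* (odd k ℕ.* odd k ℕ.^ n))        ≡⟨ inv-* (odd k) (odd k ℕ.* odd k ℕ.^ n) ⟩
  inv (odd k) * inv (odd k ℕ.* odd k ℕ.^ n)      ≡⟨ cong (inv (odd k) *_) (inv-* (odd k) (odd k ℕ.^ n)) ⟩
  inv (odd k) * (inv (odd k) * inv (odd k ℕ.^ n)) ≡⟨ *-assoc (inv (odd k)) (inv (odd k)) (inv (odd k ℕ.^ n)) ⟨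
  β k * inv (odd k ℕ.^ n)                        ∎
  where open ≡-Reasoning

innerSum : ℕ → ℕ → ℚ
innerSum i μ = sumTo μ (λ j → sgn j * inv (odd (suc i) ℕ.^ (2 ℕ.* j)) * Ht i (μ ℕ.∸ j))

-- Splitting off j = 1 and reindexing leaves -1/b_k times the sum for μ: up to sign, the recursion
-- of the geometric series a/q_k = Σ_{j≥1} (a/b_k)ʲ.
innerSum-suc : ∀ i μ → innerSum i (suc μ) ≡ - (β (suc i) * (innerSum i μ + Ht i μ))
innerSum-suc i μ = begin
  innerSum i (suc μ)
    ≡⟨ sumTo-head μ _ ⟩
  - 1ℚ * inv (odd (suc i) ℕ.^ 2) * H + sumTo μ (λ j → - sgn j * inv (odd (suc i) ℕ.^ (2 ℕ.* suc j)) * Ht i (μ ℕ.∸ j))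
    ≡⟨ cong₂ (λ u v → - 1ℚ * u * H + v) (inv-odd² (suc i)) (trans (sumTo-cong μ step) (sumTo-*ˡ μ (- b) _)) ⟩
  - 1ℚ * b * H + - b * innerSum i μ
    ≡⟨ solve 3 (λ b H T → (:- con 1ℚ) :* b :* H :+ (:- b) :* T := :- (b :* (T :+ H))) refl b H (innerSum i μ) ⟩
  - (b * (innerSum i μ + H)) ∎
  where
  open ≡-Reasoning
  b = β (suc i)
  H = Ht i μ
  step : ∀ j → - sgn j * inv (odd (suc i) ℕ.^ (2 ℕ.* suc j)) * Ht i (μ ℕ.∸ j) ≡
               - b * (sgn j * inv (odd (suc i) ℕ.^ (2 ℕ.* j)) * Ht i (μ ℕ.∸ j))
  step j = begin
    - sgn j * inv (odd (suc i) ℕ.^ (2 ℕ.* suc j)) * h  ≡⟨ cong (λ n → - sgn j * inv (odd (suc i) ℕ.^ n) * h) (ℕ.*-suc 2 j) ⟩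
    - sgn j * inv (odd (suc i) ℕ.^ (2 ℕ.+ 2 ℕ.* j)) * h ≡⟨ cong (λ z → - sgn j * z * h) (inv-odd-^ (suc i) (2 ℕ.* j)) ⟩
    - sgn j * (b * p) * h                              ≡⟨ solve 4 (λ s b p h → (:- s) :* (b :* p) :* h := (:- b) :* (s :* p :* h)) refl (sgn j) b p h ⟩
    - b * (sgn j * p * h)                              ∎
    where
    h = Ht i (μ ℕ.∸ j)
    p = inv (odd (suc i) ℕ.^ (2 ℕ.* j))

-- Coefficients of (a/q_k) D i, k = i + 1, obtained from q_k · (a/q_k) D i = a D i.
tail : ℕ → ℕ → ℚ
tail i zero    = 0ℚ
tail i (suc μ) = β (suc i) * (tail i μ + D i μ)

-- The inner sum of the series is thus a coefficient of (a/q_k) D: its sign (-1)ʲ is the quotient of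
-- the signs carried by `D i μ` and `D i (μ − j)`.
tail≡ : ∀ i μ → sgn (suc i ℕ.+ μ) * centralCoeff (suc i) * innerSum i μ ≡ tail i μ
tail≡ i zero    = *-zeroʳ (sgn (suc i ℕ.+ 0) * centralCoeff (suc i))
tail≡ i (suc μ) = begin
  sgn (suc i ℕ.+ suc μ) * c * innerSum i (suc μ)   ≡⟨ cong₂ (λ n z → sgn n * c * z) (ℕ.+-suc (suc i) μ) (innerSum-suc i μ) ⟩
  - s * c * - (b * (T + H))                        ≡⟨ solve 5 (λ s c b T H → (:- s) :* c :* (:- (b :* (T :+ H))) := b :* (s :* c :* T :+ s :* c :* H)) refl s c b T H ⟩
  b * (s * c * T + D i μ)                          ≡⟨ cong (λ z → b * (z + D i μ)) (tail≡ i μ) ⟩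
  tail i (suc μ)                                   ∎
  where
  open ≡-Reasoning
  s = sgn (suc i ℕ.+ μ); c = centralCoeff (suc i); b = β (suc i); T = innerSum i μ; H = Ht i μ

numerator : ℚ → ℚ
numerator x = ℕ→ℚ 10 * (x * (x * x)) + ℕ→ℚ 9 * (x * x) + 1ℚ - x

ℕ→ℚ-numerator : ∀ k → ℕ→ℚ (10 ℕ.* k ℕ.^ 3 ℕ.+ 9 ℕ.* k ℕ.^ 2 ℕ.+ 1) - ℕ→ℚ k ≡ numerator (ℕ→ℚ k)
ℕ→ℚ-numerator k = cong (_- ℕ→ℚ k) (trans (ℕ→ℚ-+ (10 ℕ.* k ℕ.^ 3 ℕ.+ 9 ℕ.* k ℕ.^ 2) 1) (cong (_+ 1ℚ)
  (trans (ℕ→ℚ-+ (10 ℕ.* k ℕ.^ 3) (9 ℕ.* k ℕ.^ 2)) (cong₂ _+_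
    (trans (ℕ→ℚ-* 10 (k ℕ.^ 3)) (cong (ℕ→ℚ 10 *_) (trans (ℕ→ℚ-* k (k ℕ.^ 2)) (cong (ℕ→ℚ k *_) k²))))
    (trans (ℕ→ℚ-* 9 (k ℕ.^ 2)) (cong (ℕ→ℚ 9 *_) k²))))))
  where
  k² : ℕ→ℚ (k ℕ.^ 2) ≡ ℕ→ℚ k * ℕ→ℚ k
  k² = trans (cong (λ n → ℕ→ℚ (k ℕ.* n)) (ℕ.*-identityʳ k)) (ℕ→ℚ-* k k)

2*suc∸1≡odd : ∀ i → 2 ℕ.* suc i ℕ.∸ 1 ≡ odd i
2*suc∸1≡odd i = trans (cong (ℕ._∸ 1) (ℕ.*-suc 2 i)) (sym (odd≡suc i))

term-suc : ∀ μ i → term μ (suc i) ≡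
  - (numerator (ℕ→ℚ (suc i)) * inv (odd i) * β (suc i) * D i μ
     + 4ℚ * ℕ→ℚ (suc i) * (ℕ→ℚ (suc i) + 1ℚ) * β (suc i) * tail i μ)
term-suc μ i = begin
  term μ (suc i)
    ≡⟨ cong₂ (λ u v → s * u * B * (v * inv (2 ℕ.* k ℕ.∸ 1) * H + ℕ→ℚ (4 ℕ.* k ℕ.* (k ℕ.+ 1)) * T))
             (trans (inv-* (16 ℕ.^ k) (odd k ℕ.^ 2)) (cong (h *_) (inv-odd² k))) (ℕ→ℚ-numerator k) ⟩
  s * (h * b) * B * (v * inv (2 ℕ.* k ℕ.∸ 1) * H + ℕ→ℚ (4 ℕ.* k ℕ.* (k ℕ.+ 1)) * T)
    ≡⟨ cong₂ (λ n z → s * (h * b) * B * (v * inv n * H + z * T)) (2*suc∸1≡odd i)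
             (trans (ℕ→ℚ-* (4 ℕ.* k) (k ℕ.+ 1)) (cong₂ _*_ (ℕ→ℚ-* 4 k) (ℕ→ℚ-+ k 1))) ⟩
  s * (h * b) * B * (v * w * H + F * T)
    -- The sign exponent k + μ - 1 of `term` is one less than that of `D`; this produces the overall
    -- minus.
    ≡⟨ solve 9 (λ s h b B v w H F T → s :* (h :* b) :* B :* (v :* w :* H :+ F :* T) :=
          :- (v :* w :* b :* ((:- s) :* (h :* B) :* H) :+ F :* b :* ((:- s) :* (h :* B) :* T))) refl s h b B v w H F T ⟩
  - (v * w * b * D i μ + F * b * (- s * (h * B) * T))
    ≡⟨ cong (λ z → - (v * w * b * D i μ + F * b * z)) (tail≡ i μ) ⟩
  - (v * w * b * D i μ + F * b * tail i μ) ∎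
  where
  open ≡-Reasoning
  k = suc i
  s = sgn (i ℕ.+ μ)
  h = inv (16 ℕ.^ k)
  b = β k
  B = ℕ→ℚ ((2 ℕ.* k) C k)
  v = numerator (ℕ→ℚ k)
  w = inv (odd i)
  H = Ht i μ
  F = 4ℚ * ℕ→ℚ k * (ℕ→ℚ k + 1ℚ)
  T = innerSum i μ

-- The numbers σ and the telescoping in N.

-- The ratio T_j/A_j of the header for N = j + t, equal to 1/C(N+j,2j).
σ : ℕ → ℕ → ℚ
σ j t = ℕ→ℚ ((2 ℕ.* j) ! ℕ.* t !) * inv ((2 ℕ.* j ℕ.+ t) !)

σ-zeroˡ : ∀ t → σ 0 t ≡ 1ℚ
σ-zeroˡ t = trans (cong (λ n → ℕ→ℚ n * inv (t !)) (ℕ.*-identityˡ (t !))) (inv-inverseʳ (t !) {{ℕ._!≢0 t}})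

σ-zeroʳ : ∀ j → σ j 0 ≡ 1ℚ
σ-zeroʳ j = trans (cong₂ (λ m n → ℕ→ℚ m * inv (n !)) (ℕ.*-identityʳ ((2 ℕ.* j) !)) (ℕ.+-identityʳ (2 ℕ.* j)))
                  (inv-inverseʳ ((2 ℕ.* j) !) {{ℕ._!≢0 (2 ℕ.* j)}})

-- This and `σ-sucˡ` both descend to `σ j t`. Since `σ j (suc t)` and `σ (suc j) t` belong to the
-- same N = j + t + 1, comparing the two recursions relates T_j to T_{j+1} at fixed N.
σ-sucʳ : ∀ j t → σ j (suc t) ≡ ℕ→ℚ (suc t) * inv (suc (2 ℕ.* j ℕ.+ t)) * σ j t
σ-sucʳ j t = begin
  ℕ→ℚ (f ℕ.* (suc t ℕ.* t !)) * inv ((2 ℕ.* j ℕ.+ suc t) !)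
    ≡⟨ cong₂ (λ m n → ℕ→ℚ m * inv (n !)) (S.solve 3 (λ f s g → f S.:* (s S.:* g) S.:= s S.:* (f S.:* g)) refl f (suc t) (t !)) (ℕ.+-suc (2 ℕ.* j) t) ⟩
  ℕ→ℚ (suc t ℕ.* (f ℕ.* t !)) * inv (suc n ℕ.* n !)
    ≡⟨ cong₂ _*_ (ℕ→ℚ-* (suc t) (f ℕ.* t !)) (inv-* (suc n) (n !)) ⟩
  ℕ→ℚ (suc t) * a * (inv (suc n) * u)
    ≡⟨ solve 4 (λ y a q u → y :* a :* (q :* u) := y :* q :* (a :* u)) refl (ℕ→ℚ (suc t)) a (inv (suc n)) u ⟩
  ℕ→ℚ (suc t) * inv (suc n) * (a * u) ∎
  where
  open ≡-Reasoning
  f = (2 ℕ.* j) !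
  n = 2 ℕ.* j ℕ.+ t
  a = ℕ→ℚ (f ℕ.* t !)
  u = inv (n !)

σ-sucˡ : ∀ j t → σ (suc j) t ≡
         2ℚ * ℕ→ℚ (suc j) * ℕ→ℚ (odd j) * (inv (2 ℕ.+ (2 ℕ.* j ℕ.+ t)) * inv (suc (2 ℕ.* j ℕ.+ t))) * σ j t
σ-sucˡ j t = begin
  ℕ→ℚ ((2 ℕ.* suc j) ! ℕ.* t !) * inv ((2 ℕ.* suc j ℕ.+ t) !)
    ≡⟨ cong (λ m → ℕ→ℚ (m ! ℕ.* t !) * inv ((m ℕ.+ t) !)) (ℕ.*-suc 2 j) ⟩
  ℕ→ℚ ((2 ℕ.+ 2 ℕ.* j) ! ℕ.* t !) * inv ((2 ℕ.+ n) ℕ.* (suc n ℕ.* n !))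
    ≡⟨ cong₂ (λ m z → ℕ→ℚ m * z)
         (S.solve 3 (λ j f g → (S.con 2 S.:+ S.con 2 S.:* j) S.:* ((S.con 1 S.:+ S.con 2 S.:* j) S.:* f) S.:* g
            S.:= S.con 2 S.:* (S.con 1 S.:+ j) S.:* (S.con 2 S.:* j S.:+ S.con 1) S.:* (f S.:* g)) refl j f (t !))
         (trans (inv-* (2 ℕ.+ n) (suc n ℕ.* n !)) (cong (inv (2 ℕ.+ n) *_) (inv-* (suc n) (n !)))) ⟩
  ℕ→ℚ (2 ℕ.* suc j ℕ.* odd j ℕ.* (f ℕ.* t !)) * (q₂ * (q₁ * u))
    ≡⟨ cong (_* (q₂ * (q₁ * u))) (trans (ℕ→ℚ-* (2 ℕ.* suc j ℕ.* odd j) (f ℕ.* t !)) (cong (_* a)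
         (trans (ℕ→ℚ-* (2 ℕ.* suc j) (odd j)) (cong (_* ℕ→ℚ (odd j)) (ℕ→ℚ-* 2 (suc j)))))) ⟩
  2ℚ * ℕ→ℚ (suc j) * ℕ→ℚ (odd j) * a * (q₂ * (q₁ * u))
    ≡⟨ solve 6 (λ x y a q₂ q₁ u → con 2ℚ :* x :* y :* a :* (q₂ :* (q₁ :* u)) := con 2ℚ :* x :* y :* (q₂ :* q₁) :* (a :* u)) refl
         (ℕ→ℚ (suc j)) (ℕ→ℚ (odd j)) a q₂ q₁ u ⟩
  2ℚ * ℕ→ℚ (suc j) * ℕ→ℚ (odd j) * (q₂ * q₁) * (a * u) ∎
  where
  open ≡-Reasoning
  f = (2 ℕ.* j) !
  n = 2 ℕ.* j ℕ.+ t
  a = ℕ→ℚ (f ℕ.* t !)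
  u = inv (n !)
  q₁ = inv (suc n)
  q₂ = inv (2 ℕ.+ n)

-- Chosen so that e (N−1) k − e N k = σ k (N−k)/(b_N − b_k): this is the telescoping in N.
e : ℕ → ℕ → ℚ
e N k = inv 4 * inv (odd k) * inv (suc (N ℕ.+ k)) * σ k (N ℕ.∸ k)

Δ : ℕ → ℕ → ℚ
Δ M k = e M k - e (suc M) k

b : ℕ → ℚ
b k = ℕ→ℚ (odd k) * ℕ→ℚ (odd k)

k+t+k≡2k+t : ∀ k t → k ℕ.+ t ℕ.+ k ≡ 2 ℕ.* k ℕ.+ t
k+t+k≡2k+t = S.solve 2 (λ k t → k S.:+ t S.:+ k S.:= S.con 2 S.:* k S.:+ t) refl

2k+t+2-inverse : ∀ k t → (1ℚ + 2ℚ * ℕ→ℚ k + ℕ→ℚ (suc t)) * inv (2 ℕ.+ (2 ℕ.* k ℕ.+ t)) ≡ 1ℚ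
2k+t+2-inverse k t = begin
  (1ℚ + 2ℚ * ℕ→ℚ k + ℕ→ℚ (suc t)) * q₂   ≡⟨ cong (λ z → (1ℚ + z + ℕ→ℚ (suc t)) * q₂) (ℕ→ℚ-* 2 k) ⟨
  (1ℚ + ℕ→ℚ (2 ℕ.* k) + ℕ→ℚ (suc t)) * q₂ ≡⟨ cong (λ z → (z + ℕ→ℚ (suc t)) * q₂) (ℕ→ℚ-+ 1 (2 ℕ.* k)) ⟨
  (ℕ→ℚ (suc (2 ℕ.* k)) + ℕ→ℚ (suc t)) * q₂ ≡⟨ cong (_* q₂) (ℕ→ℚ-+ (suc (2 ℕ.* k)) (suc t)) ⟨
  ℕ→ℚ (suc (2 ℕ.* k ℕ.+ suc t)) * q₂      ≡⟨ cong (λ m → ℕ→ℚ (suc m) * q₂) (ℕ.+-suc (2 ℕ.* k) t) ⟩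
  ℕ→ℚ (2 ℕ.+ n) * q₂                      ≡⟨ inv-inverseʳ (2 ℕ.+ n) ⟩
  1ℚ                                      ∎
  where
  open ≡-Reasoning
  n = 2 ℕ.* k ℕ.+ t
  q₂ = inv (2 ℕ.+ n)

-- With N = k + t + 1, the difference (N + k + 1) - (N - k) = 2k + 1 cancels the factor 1/(2k+1) of
-- `e`.
Δ-closed : ∀ k t → Δ (k ℕ.+ t) k ≡ inv 4 * (inv (2 ℕ.+ (2 ℕ.* k ℕ.+ t)) * inv (suc (2 ℕ.* k ℕ.+ t))) * σ k t
Δ-closed k t = begin
  e (k ℕ.+ t) k - e (suc (k ℕ.+ t)) k
    ≡⟨ cong₂ (λ m m′ → inv 4 * d * inv (suc (k ℕ.+ t ℕ.+ k)) * σ k m - inv 4 * d * inv (2 ℕ.+ (k ℕ.+ t ℕ.+ k)) * σ k m′) (ℕ.m+n∸m≡n k t)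
         (trans (cong (ℕ._∸ k) (sym (ℕ.+-suc k t))) (ℕ.m+n∸m≡n k (suc t))) ⟩
  inv 4 * d * inv (suc (k ℕ.+ t ℕ.+ k)) * s - inv 4 * d * inv (2 ℕ.+ (k ℕ.+ t ℕ.+ k)) * σ k (suc t)
    ≡⟨ cong₂ (λ m z → inv 4 * d * inv (suc m) * s - inv 4 * d * inv (2 ℕ.+ m) * z) (k+t+k≡2k+t k t) (σ-sucʳ k t) ⟩
  inv 4 * d * q₁ * s - inv 4 * d * q₂ * (ℕ→ℚ (suc t) * q₁ * s)
    ≡⟨ linear-combination₂ (- (inv 4 * d * q₁ * s)) (inv 4 * q₁ * q₂ * s) (2k+t+2-inverse k t) (odd-inverse k)
         (solve 6 (λ x y d q₁ q₂ s → con (inv 4) :* d :* q₁ :* s :- con (inv 4) :* d :* q₂ :* (y :* q₁ :* s) :=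
            con (inv 4) :* (q₂ :* q₁) :* s :+ (:- (con (inv 4) :* d :* q₁ :* s)) :* ((con 1ℚ :+ con 2ℚ :* x :+ y) :* q₂ :- con 1ℚ)
            :+ con (inv 4) :* q₁ :* q₂ :* s :* ((con 2ℚ :* x :+ con 1ℚ) :* d :- con 1ℚ)) refl
            (ℕ→ℚ k) (ℕ→ℚ (suc t)) d q₁ q₂ s) ⟩
  inv 4 * (q₂ * q₁) * s ∎
  where
  open ≡-Reasoning
  n = 2 ℕ.* k ℕ.+ t
  d = inv (odd k)
  q₁ = inv (suc n)
  q₂ = inv (2 ℕ.+ n)
  s = σ k t

-- Rests on b_N - b_k = 4 (N - k)(N + k + 1), where N - k = t + 1 and N + k + 1 = 2k + t + 2.
Δ*gap : ∀ k t → Δ (k ℕ.+ t) k * (b (suc (k ℕ.+ t)) - b k) ≡ σ k (suc t)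
Δ*gap k t = begin
  Δ (k ℕ.+ t) k * (b (suc (k ℕ.+ t)) - b k)
    ≡⟨ cong₂ _*_ (Δ-closed k t) (cong₂ (λ u v → u * u - v * v) bigOdd (ℕ→ℚ-odd k)) ⟩
  inv 4 * (q₂ * q₁) * s * ((2ℚ * (x + y) + 1ℚ) * (2ℚ * (x + y) + 1ℚ) - (2ℚ * x + 1ℚ) * (2ℚ * x + 1ℚ))
    ≡⟨ linear-combination₁ (y * q₁ * s) (2k+t+2-inverse k t)
         (solve 5 (λ x y q₁ q₂ s → con (inv 4) :* (q₂ :* q₁) :* s :* ((con 2ℚ :* (x :+ y) :+ con 1ℚ) :* (con 2ℚ :* (x :+ y) :+ con 1ℚ) :- (con 2ℚ :* x :+ con 1ℚ) :* (con 2ℚ :* x :+ con 1ℚ))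
           := y :* q₁ :* s :+ y :* q₁ :* s :* ((con 1ℚ :+ con 2ℚ :* x :+ y) :* q₂ :- con 1ℚ)) refl x y q₁ q₂ s) ⟩
  y * q₁ * s
    ≡⟨ σ-sucʳ k t ⟨
  σ k (suc t) ∎
  where
  open ≡-Reasoning
  x = ℕ→ℚ k
  y = ℕ→ℚ (suc t)
  n = 2 ℕ.* k ℕ.+ t
  q₁ = inv (suc n)
  q₂ = inv (2 ℕ.+ n)
  s = σ k t
  bigOdd : ℕ→ℚ (odd (suc (k ℕ.+ t))) ≡ 2ℚ * (x + y) + 1ℚ
  bigOdd = trans (ℕ→ℚ-odd (suc (k ℕ.+ t))) (cong (λ z → 2ℚ * z + 1ℚ) (trans (cong ℕ→ℚ (sym (ℕ.+-suc k t))) (ℕ→ℚ-+ k (suc t))))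

-- Combined with `A-suc` and `Δ*gap`, this gives T_{k+1} = T_k (a - b_k)/(b_N - b_k) for T_k =
-- `σ k (N − k)` A_k.
σ-sucˡ-A : ∀ k t → σ (suc k) t * (ratio k * β k) ≡ Δ (k ℕ.+ t) k
σ-sucˡ-A k t = begin
  σ (suc k) t * (ratio k * β k)
    ≡⟨ cong₂ _*_ (σ-sucˡ k t) (trans (ratio-odd k) (cong (_* d) (inv-* 8 (suc k)))) ⟩
  2ℚ * ℕ→ℚ (suc k) * ℕ→ℚ (odd k) * q * s * (inv 8 * m * d)
    ≡⟨ linear-combination₂ (inv 4 * q * s * (ℕ→ℚ (odd k) * d)) (inv 4 * q * s) (inv-inverseʳ (suc k)) (inv-inverseʳ (odd k) {{odd≢0 k}})
        (solve 6 (λ x o q s m d → con 2ℚ :* x :* o :* q :* s :* (con (inv 8) :* m :* d) := con (inv 4) :* q :* s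
          :+ con (inv 4) :* q :* s :* (o :* d) :* (x :* m :- con 1ℚ) :+ con (inv 4) :* q :* s :* (o :* d :- con 1ℚ)) refl
          (ℕ→ℚ (suc k)) (ℕ→ℚ (odd k)) q s m d) ⟩
  inv 4 * q * s
    ≡⟨ Δ-closed k t ⟨
  Δ (k ℕ.+ t) k ∎
  where
  open ≡-Reasoning
  d = inv (odd k)
  m = inv (suc k)
  q = inv (2 ℕ.+ (2 ℕ.* k ℕ.+ t)) * inv (suc (2 ℕ.* k ℕ.+ t))
  s = σ k t

-- The expansion of 1/q_N.

∑ : ℕ → (ℕ → ℚ) → ℚ
∑ zero    f = 0ℚ
∑ (suc n) f = ∑ n f + f n

-- For N = M + 1 and j ≤ N this is the partial sum Σ_{k<j} T_k/(b_N - b_k).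
W : ℕ → ℕ → ℕ → ℚ
W M j μ = ∑ j (λ k → Δ M k * A k μ)

shift-W-suc : ∀ M j μ → shift (W M (suc j)) μ ≡ shift (W M j) μ + Δ M j * shift (A j) μ
shift-W-suc M j zero    = sym (trans (+-identityˡ (Δ M j * 0ℚ)) (*-zeroʳ (Δ M j)))
shift-W-suc M j (suc μ) = refl

-- Writing q_N = (b_N - b_k) - (a - b_k) gives q_N T_k/(b_N - b_k) = T_k - T_{k+1}, so that q_N
-- times the partial sum collapses to T_0 - T_j with T_0 = 1. The left side is multiplication by q_N
-- on coefficients.
W-telescopes : ∀ M j t μ → j ℕ.+ t ≡ suc M → b (suc M) * W M j μ - shift (W M j) μ ≡ δ μ - σ j t * A j μ
W-telescopes M zero t μ eq = begin
  b (suc M) * 0ℚ - shift (W M 0) μ   ≡⟨ cong₂ (λ u v → u - v) (*-zeroʳ (b (suc M))) (shift-0 μ) ⟩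
  0ℚ - 0ℚ                            ≡⟨ solve 1 (λ d → con 0ℚ :- con 0ℚ := d :- con 1ℚ :* d) refl (δ μ) ⟩
  δ μ - 1ℚ * δ μ                     ≡⟨ cong (λ z → δ μ - z * δ μ) (σ-zeroˡ t) ⟨
  δ μ - σ 0 t * δ μ                  ∎
  where
  open ≡-Reasoning
  shift-0 : ∀ μ → shift (W M 0) μ ≡ 0ℚ
  shift-0 zero    = refl
  shift-0 (suc μ) = refl
W-telescopes .(j ℕ.+ t) (suc j) t μ refl = begin
  B * (w + x * a) - shift (W M (suc j)) μ       ≡⟨ cong (λ z → B * (w + x * a) - z) (shift-W-suc M j μ) ⟩
  B * (w + x * a) - (w⁻ + x * a⁻)               ≡⟨ linear-combination₂ 1ℚ a ih (Δ*gap j t)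
     (solve 9 (λ B c w x a w⁻ a⁻ s d → B :* (w :+ x :* a) :- (w⁻ :+ x :* a⁻) := d :- x :* (a⁻ :- c :* a)
        :+ con 1ℚ :* (B :* w :- w⁻ :- (d :- s :* a)) :+ a :* (x :* (B :- c) :- s)) refl B (b j) w x a w⁻ a⁻ (σ j (suc t)) (δ μ)) ⟩
  δ μ - x * (a⁻ - b j * a)                      ≡⟨ cong (λ z → δ μ - z * (a⁻ - b j * a)) (σ-sucˡ-A j t) ⟨
  δ μ - σ (suc j) t * (ratio j * β j) * (a⁻ - b j * a) ≡⟨ cong (λ z → δ μ - z) (trans (*-assoc (σ (suc j) t) (ratio j * β j) (a⁻ - b j * a)) (cong (σ (suc j) t *_) (sym (A-suc j μ)))) ⟩
  δ μ - σ (suc j) t * A (suc j) μ               ∎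
  where
  open ≡-Reasoning
  M = j ℕ.+ t
  B = b (suc M)
  w = W M j μ
  w⁻ = shift (W M j) μ
  x = Δ M j
  a = A j μ
  a⁻ = shift (A j) μ
  ih : B * w - w⁻ ≡ δ μ - σ j (suc t) * a
  ih = W-telescopes M j (suc t) μ (ℕ.+-suc j t)

-- Coefficients of 1/q_k.
βpow : ℕ → ℕ → ℚ
βpow k zero    = β k
βpow k (suc μ) = β k * βpow k μ

-- W-telescopes at j = N says q_N W = 1 − A_N; dividing by q_N is an induction on μ, and
-- A_N/q_N = (1 − a) D/q_N = D/b_N − (b_N − 1)/b_N · (a/q_N) D.
W-closed : ∀ M μ → W M (suc M) μ ≡
  βpow (suc M) μ - β (suc M) * D M μ + (b (suc M) - 1ℚ) * β (suc M) * tail M μ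
W-closed M μ = go μ
  where
  open ≡-Reasoning
  N = suc M
  β′ = β N
  hyp : ∀ μ → b N * W M N μ - shift (W M N) μ ≡ δ μ - 1ℚ * A N μ
  hyp μ = trans (W-telescopes M N 0 μ (ℕ.+-identityʳ N)) (cong (λ z → δ μ - z * A N μ) (σ-zeroʳ N))
  go : ∀ μ → W M N μ ≡ βpow N μ - β′ * D M μ + (b N - 1ℚ) * β′ * tail M μ
  go zero = linear-combination₂ β′ (- W M N 0) (hyp 0) (ℕ→ℚ-odd² N)
    (solve 4 (λ w b β d → w := β :- β :* d :+ (b :- con 1ℚ) :* β :* con 0ℚ :+ β :* (b :* w :- con 0ℚ :- (con 1ℚ :- con 1ℚ :* (d :- con 0ℚ)))
      :+ (:- w) :* (b :* β :- con 1ℚ)) refl (W M N 0) (b N) β′ (D M 0))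
  go (suc μ) = linear-combination₂ β′ (- (β′ * D M μ) - W M N (suc μ)) hyp′ (ℕ→ℚ-odd² N)
    (solve 7 (λ w b β d d⁻ p g → w := β :* p :- β :* d :+ (b :- con 1ℚ) :* β :* (β :* (g :+ d⁻))
      :+ β :* (b :* w :- (p :- β :* d⁻ :+ (b :- con 1ℚ) :* β :* g) :- (con 0ℚ :- con 1ℚ :* (d :- d⁻)))
      :+ (:- (β :* d⁻) :- w) :* (b :* β :- con 1ℚ)) refl (W M N (suc μ)) (b N) β′ (D M (suc μ)) (D M μ) (βpow N μ) (tail M μ))
    where
    hyp′ : b N * W M N (suc μ) - (βpow N μ - β′ * D M μ + (b N - 1ℚ) * β′ * tail M μ) ≡ 0ℚ - 1ℚ * A N (suc μ)
    hyp′ = trans (cong (λ z → b N * W M N (suc μ) - z) (sym (go μ))) (hyp (suc μ))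

-- Summation over N and the finite identity.

E V : ℕ → ℕ → ℚ
E N μ = ∑ (suc N) (λ k → e N k * A k μ)
V N μ = - (2ℚ * (ℕ→ℚ (suc N) * inv (odd N)) * D N μ)

∑-Δ : ∀ M n μ → ∑ n (λ k → e M k * A k μ) - ∑ n (λ k → e (suc M) k * A k μ) ≡ W M n μ
∑-Δ M zero    μ = refl
∑-Δ M (suc n) μ = trans
  (solve 5 (λ s s′ x y a → s :+ x :* a :- (s′ :+ y :* a) := s :- s′ :+ (x :- y) :* a) refl
     (∑ n (λ k → e M k * A k μ)) (∑ n (λ k → e (suc M) k * A k μ)) (e M n) (e (suc M) n) (A n μ))
  (cong (_+ Δ M n * A n μ) (∑-Δ M n μ))

-- For index k the telescoping in N starts at `e k k`; this is the origin of the correction 1/(4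
-- b_k).
e-diagonal : ∀ N → e N N ≡ inv 4 * β N
e-diagonal N = begin
  inv 4 * d * inv (suc (N ℕ.+ N)) * σ N (N ℕ.∸ N)  ≡⟨ cong₂ (λ m t → inv 4 * d * inv m * σ N t) (S.solve 1 (λ N → S.con 1 S.:+ (N S.:+ N) S.:= S.con 2 S.:* N S.:+ S.con 1) refl N) (ℕ.n∸n≡0 N) ⟩
  inv 4 * d * d * σ N 0                            ≡⟨ cong (inv 4 * d * d *_) (σ-zeroʳ N) ⟩
  inv 4 * d * d * 1ℚ                               ≡⟨ solve 1 (λ d → con (inv 4) :* d :* d :* con 1ℚ := con (inv 4) :* (d :* d)) refl d ⟩
  inv 4 * (d * d)                                  ∎
  where
  open ≡-Reasoning
  d = inv (odd N)

-- The indices k ≤ M common to both sums contribute the differences collected in `W`; the new index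
-- k = M + 1 contributes its diagonal value.
E-suc : ∀ M μ → E M μ - E (suc M) μ ≡ W M (suc M) μ - inv 4 * β (suc M) * A (suc M) μ
E-suc M μ = begin
  s - (s′ + e N N * a)          ≡⟨ cong (λ z → s - (s′ + z * a)) (e-diagonal N) ⟩
  s - (s′ + inv 4 * β N * a)    ≡⟨ solve 3 (λ s s′ x → s :- (s′ :+ x) := s :- s′ :- x) refl s s′ (inv 4 * β N * a) ⟩
  s - s′ - inv 4 * β N * a      ≡⟨ cong (λ z → z - inv 4 * β N * a) (∑-Δ M N μ) ⟩
  W M N μ - inv 4 * β N * a     ∎
  where
  open ≡-Reasoning
  N = suc M
  s = ∑ N (λ k → e M k * A k μ)
  s′ = ∑ N (λ k → e N k * A k μ)
  a = A N μ

-- The prefactor 2 (N+1)/(2N+1) in `V` cancels against `ratio N` = (2N+1)/(8 (N+1)), leaving 1/4.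
-- Both `V (suc M)` and `V M` are then expressed through the one sequence `D M`.
V-suc : ∀ M μ → V (suc M) μ ≡ inv 4 * (D M μ - β (suc M) * shift (D M) μ)
V-suc M μ = begin
  - (2ℚ * (y * inv o) * D N μ)                          ≡⟨ cong (λ z → - (2ℚ * (y * inv o) * z)) (D-suc M μ) ⟩
  - (2ℚ * (y * inv o) * - (ℕ→ℚ o * inv (8 ℕ.* suc N) * x)) ≡⟨ cong (λ z → - (2ℚ * (y * inv o) * - (ℕ→ℚ o * z * x))) (inv-* 8 (suc N)) ⟩
  - (2ℚ * (y * inv o) * - (ℕ→ℚ o * (inv 8 * inv (suc N)) * x))
    ≡⟨ linear-combination₂ (inv 4 * x * (y * inv (suc N))) (inv 4 * x) (inv-inverseʳ o {{odd≢0 N}}) (inv-inverseʳ (suc N))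
      (solve 5 (λ y d o m x → :- (con 2ℚ :* (y :* d) :* (:- (o :* (con (inv 8) :* m) :* x))) := con (inv 4) :* x
         :+ con (inv 4) :* x :* (y :* m) :* (o :* d :- con 1ℚ) :+ con (inv 4) :* x :* (y :* m :- con 1ℚ)) refl y (inv o) (ℕ→ℚ o) (inv (suc N)) x) ⟩
  inv 4 * x                                             ∎
  where
  open ≡-Reasoning
  N = suc M
  o = odd N
  y = ℕ→ℚ (suc N)
  x = D M μ - β N * shift (D M) μ

step : ∀ M μ → βpow (suc M) μ - term μ (suc M) ≡ E M μ - E (suc M) μ + V (suc M) μ - V M μ
step M μ = begin
  p - term μ N
    ≡⟨ cong (λ z → p - z) (term-suc μ M) ⟩
  p - - (numerator x * w * (d * d) * D M μ + 4ℚ * x * (x + 1ℚ) * (d * d) * g)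
    -- Coefficients are compared. The shifted terms cancel, and 4x(x+1) = (2x+1)² - 1 matches the
    -- multiples of `g`. For `D M μ` what remains is the partial fraction decomposition of
    -- `numerator x`/((2x-1)(2x+1)²) as 1/4 - 5/(4(2x+1)²) + 2x/(2x-1).
    ≡⟨ linear-combination₂ (D M μ * (inv 4 - ℕ→ℚ 5 * inv 4 * (d * d)))
          (D M μ * (1ℚ + (2ℚ * x + 1ℚ) * d) * (inv 4 * ((2ℚ * x - 1ℚ) * w) + 2ℚ * (x * w))) hypW (odd-inverse N)
       (solve 7 (λ x w d q q⁻ p g →
         p :- (:- ((con (ℕ→ℚ 10) :* (x :* (x :* x)) :+ con (ℕ→ℚ 9) :* (x :* x) :+ con 1ℚ :- x) :* w :* (d :* d) :* q :+ con 4ℚ :* x :* (x :+ con 1ℚ) :* (d :* d) :* g))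
         := p :- d :* d :* q :+ ((con 2ℚ :* x :+ con 1ℚ) :* (con 2ℚ :* x :+ con 1ℚ) :- con 1ℚ) :* (d :* d) :* g
             :- con (inv 4) :* (d :* d) :* (q :- q⁻) :+ con (inv 4) :* (q :- d :* d :* q⁻) :- (:- (con 2ℚ :* (x :* w) :* q))
           :+ q :* (con (inv 4) :- con (ℕ→ℚ 5) :* con (inv 4) :* (d :* d)) :* ((con 2ℚ :* x :- con 1ℚ) :* w :- con 1ℚ)
           :+ q :* (con 1ℚ :+ (con 2ℚ :* x :+ con 1ℚ) :* d) :* (con (inv 4) :* ((con 2ℚ :* x :- con 1ℚ) :* w) :+ con 2ℚ :* (x :* w)) :* ((con 2ℚ :* x :+ con 1ℚ) :* d :- con 1ℚ))
         refl x w d (D M μ) (shift (D M) μ) p g) ⟩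
  p - β N * D M μ + ((2ℚ * x + 1ℚ) * (2ℚ * x + 1ℚ) - 1ℚ) * β N * g - inv 4 * β N * A N μ + inv 4 * (D M μ - β N * shift (D M) μ) - V M μ
    ≡⟨ cong (λ o → p - β N * D M μ + (o * o - 1ℚ) * β N * g - inv 4 * β N * A N μ + inv 4 * (D M μ - β N * shift (D M) μ) - V M μ) (ℕ→ℚ-odd N) ⟨
  p - β N * D M μ + (b N - 1ℚ) * β N * g - inv 4 * β N * A N μ + inv 4 * (D M μ - β N * shift (D M) μ) - V M μ
    ≡⟨ cong₂ (λ u v → u - inv 4 * β N * A N μ + v - V M μ) (W-closed M μ) (V-suc M μ) ⟨
  W M N μ - inv 4 * β N * A N μ + V N μ - V M μ
    ≡⟨ cong (λ z → z + V N μ - V M μ) (E-suc M μ) ⟨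
  E M μ - E N μ + V N μ - V M μ ∎
  where
  open ≡-Reasoning
  N = suc M
  x = ℕ→ℚ N
  w = inv (odd M)
  d = inv (odd N)
  p = βpow N μ
  g = tail M μ
  hypW : (2ℚ * x - 1ℚ) * w ≡ 1ℚ
  hypW = trans (cong (λ z → (2ℚ * z - 1ℚ) * w) (ℕ→ℚ-+ 1 M))
         (trans (solve 2 (λ y w → (con 2ℚ :* (con 1ℚ :+ y) :- con 1ℚ) :* w := (con 2ℚ :* y :+ con 1ℚ) :* w) refl (ℕ→ℚ M) w) (odd-inverse M))

-- The leading 1 is the summand n = 0, since `sumTo` starts at 1.
oddSum : ℕ → ℕ → ℚ
oddSum μ N = 1ℚ + sumTo N (λ n → βpow n μ)

finite-identity : ∀ μ N → oddSum μ N - rhsPartial μ N ≡ V N μ - E N μ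
finite-identity μ zero = begin
  -- At N = 0 both `V` and `E` equal δ/4.
  0ℚ                                                  ≡⟨ solve 1 (λ d → con 0ℚ := :- (con (2ℚ * (ℕ→ℚ 1 * inv 1)) :* (:- (con (inv 8) :* d))) :- (con 0ℚ :+ con (e 0 0) :* d)) refl (δ μ) ⟩
  - (2ℚ * (ℕ→ℚ 1 * inv 1) * - (inv 8 * δ μ)) - E 0 μ  ≡⟨ cong (λ z → - (2ℚ * (ℕ→ℚ 1 * inv 1) * z) - E 0 μ) (D-zero μ) ⟨
  V 0 μ - E 0 μ                                       ∎
  where open ≡-Reasoning
finite-identity μ (suc M) = begin
  1ℚ + (s + p) - (1ℚ + (s′ + t))        ≡⟨ solve 4 (λ s s′ p t → con 1ℚ :+ (s :+ p) :- (con 1ℚ :+ (s′ :+ t)) := con 1ℚ :+ s :- (con 1ℚ :+ s′) :+ (p :- t)) refl s s′ p t ⟩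
  oddSum μ M - rhsPartial μ M + (p - t) ≡⟨ cong₂ _+_ (finite-identity μ M) (step M μ) ⟩
  V M μ - E M μ + (E M μ - E N μ + V N μ - V M μ) ≡⟨ solve 4 (λ v v′ e e′ → v :- e :+ (e :- e′ :+ v′ :- v) := v′ :- e′) refl (V M μ) (V N μ) (E M μ) (E N μ) ⟩
  V N μ - E N μ                         ∎
  where
  open ≡-Reasoning
  N = suc M
  s = sumTo M (λ n → βpow n μ)
  s′ = sumTo M (term μ)
  p = βpow N μ
  t = term μ N

-- Estimates for the error terms, uniform in μ.

*-mono-≤-nonNeg : ∀ {p q r s} → 0ℚ ≤ q → 0ℚ ≤ r → p ≤ q → r ≤ s → p * r ≤ q * s
*-mono-≤-nonNeg {p} {q} {r} {s} 0≤q 0≤r p≤q r≤s =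
  ≤-trans (*-monoʳ-≤-nonNeg r {{nonNegative 0≤r}} p≤q) (*-monoˡ-≤-nonNeg q {{nonNegative 0≤q}} r≤s)

*-nonNeg : ∀ {p q} → 0ℚ ≤ p → 0ℚ ≤ q → 0ℚ ≤ p * q
*-nonNeg {p} {q} 0≤p 0≤q = subst (_≤ p * q) (*-zeroʳ p) (*-monoˡ-≤-nonNeg p {{nonNegative 0≤p}} 0≤q)

∣p∣*-mono : ∀ {p q c d} → 0ℚ ≤ p → p ≤ c → ∣ q ∣ ≤ d → ∣ p * q ∣ ≤ c * d
∣p∣*-mono {p} {q} {c} {d} 0≤p p≤c q≤d = begin
  ∣ p * q ∣      ≡⟨ ∣p*q∣≡∣p∣*∣q∣ p q ⟩
  ∣ p ∣ * ∣ q ∣  ≡⟨ cong (_* ∣ q ∣) (0≤p⇒∣p∣≡p 0≤p) ⟩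
  p * ∣ q ∣      ≤⟨ *-mono-≤-nonNeg (≤-trans 0≤p p≤c) (0≤∣p∣ q) p≤c q≤d ⟩
  c * d          ∎
  where open ≤-Reasoning

∣p-q∣≤ : ∀ {p q c d} → ∣ p ∣ ≤ c → ∣ q ∣ ≤ d → ∣ p - q ∣ ≤ c + d
∣p-q∣≤ {p} {q} p≤c q≤d = ≤-trans (∣p-q∣≤∣p∣+∣q∣ p q) (+-mono-≤ p≤c q≤d)

inv-2^-double : ∀ n → inv (2 ℕ.^ suc n) + inv (2 ℕ.^ suc n) ≡ inv (2 ℕ.^ n)
inv-2^-double n = trans (cong (λ z → z + z) (inv-* 2 (2 ℕ.^ n)))
  (solve 1 (λ h → con (inv 2) :* h :+ con (inv 2) :* h := h) refl (inv (2 ℕ.^ n)))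

fraction≤1 : ∀ {m n} .{{_ : NonZero n}} → m ℕ.≤ n → ℕ→ℚ m * inv n ≤ 1ℚ
fraction≤1 {m} {n} m≤n = subst (ℕ→ℚ m * inv n ≤_) (inv-inverseʳ n) (*-monoʳ-≤-nonNeg (inv n) {{nonNegative (0≤inv n)}} (ℕ→ℚ-mono-≤ m≤n))

0≤β : ∀ k → 0ℚ ≤ β k
0≤β k = *-nonNeg (0≤inv (odd k)) (0≤inv (odd k))

β≤1 : ∀ k → β k ≤ 1ℚ
β≤1 k = *-mono-≤-nonNeg {s = 1ℚ} (0≤ℕ→ℚ 1) (0≤inv (odd k)) (inv≤1 (odd k)) (inv≤1 (odd k))

0≤ratio : ∀ k → 0ℚ ≤ ratio k
0≤ratio k = *-nonNeg (0≤ℕ→ℚ (odd k)) (0≤inv (8 ℕ.* suc k))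

ratio≤¼ : ∀ k → ratio k ≤ inv 4
ratio≤¼ k = begin
  ℕ→ℚ (odd k) * inv (8 ℕ.* suc k)                ≤⟨ *-monoʳ-≤-nonNeg (inv (8 ℕ.* suc k)) {{nonNegative (0≤inv (8 ℕ.* suc k))}} (ℕ→ℚ-mono-≤ odd≤) ⟩
  ℕ→ℚ (2 ℕ.* suc k) * inv (8 ℕ.* suc k)          ≡⟨ cong (λ n → ℕ→ℚ (2 ℕ.* suc k) * inv n) (ℕ.*-assoc 4 2 (suc k)) ⟩
  ℕ→ℚ (2 ℕ.* suc k) * inv (4 ℕ.* (2 ℕ.* suc k))  ≡⟨ cong (ℕ→ℚ (2 ℕ.* suc k) *_) (inv-* 4 (2 ℕ.* suc k)) ⟩
  ℕ→ℚ (2 ℕ.* suc k) * (inv 4 * inv (2 ℕ.* suc k)) ≡⟨ solve 2 (λ x m → x :* (con (inv 4) :* m) := con (inv 4) :* (x :* m)) refl (ℕ→ℚ (2 ℕ.* suc k)) (inv (2 ℕ.* suc k)) ⟩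
  inv 4 * (ℕ→ℚ (2 ℕ.* suc k) * inv (2 ℕ.* suc k)) ≡⟨ cong (inv 4 *_) (inv-inverseʳ (2 ℕ.* suc k)) ⟩
  inv 4 * 1ℚ                                     ≡⟨ *-identityʳ (inv 4) ⟩
  inv 4                                          ∎
  where
  open ≤-Reasoning
  odd≤ : odd k ℕ.≤ 2 ℕ.* suc k
  odd≤ = subst₂ ℕ._≤_ (sym (odd≡suc k)) (sym (ℕ.*-suc 2 k)) (ℕ.n≤1+n (suc (2 ℕ.* k)))

∣shift∣≤ : ∀ {f c} → 0ℚ ≤ c → (∀ μ → ∣ f μ ∣ ≤ c) → ∀ μ → ∣ shift f μ ∣ ≤ c
∣shift∣≤ 0≤c f≤c zero    = 0≤c
∣shift∣≤ 0≤c f≤c (suc μ) = f≤c μ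

∣δ∣≤1 : ∀ μ → ∣ δ μ ∣ ≤ 1ℚ
∣δ∣≤1 zero    = ≤-refl
∣δ∣≤1 (suc μ) = 0≤ℕ→ℚ 1

-- By `D-suc` each step costs at most a factor (1/4)(1 + 1) = 1/2, starting from 1/8.
∣D∣≤ : ∀ i μ → ∣ D i μ ∣ ≤ inv (2 ℕ.^ (3 ℕ.+ i))
∣D∣≤ zero μ = begin
  ∣ D 0 μ ∣           ≡⟨ cong ∣_∣ (D-zero μ) ⟩
  ∣ - (inv 8 * δ μ) ∣ ≡⟨ ∣-p∣≡∣p∣ (inv 8 * δ μ) ⟩
  ∣ inv 8 * δ μ ∣     ≤⟨ ∣p∣*-mono {c = inv 8} (0≤inv 8) ≤-refl (∣δ∣≤1 μ) ⟩
  inv 8 * 1ℚ          ∎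
  where open ≤-Reasoning
∣D∣≤ (suc i) μ = begin
  ∣ D (suc i) μ ∣                                  ≡⟨ cong ∣_∣ (D-suc i μ) ⟩
  ∣ - (ratio (suc i) * y) ∣                        ≡⟨ ∣-p∣≡∣p∣ (ratio (suc i) * y) ⟩
  ∣ ratio (suc i) * y ∣                            ≤⟨ ∣p∣*-mono (0≤ratio (suc i)) (ratio≤¼ (suc i))
      (∣p-q∣≤ (∣D∣≤ i μ) (∣p∣*-mono (0≤β (suc i)) (β≤1 (suc i)) (∣shift∣≤ (0≤inv (2 ℕ.^ (3 ℕ.+ i))) (∣D∣≤ i) μ))) ⟩
  inv 4 * (h + 1ℚ * h)                             ≡⟨ solve 1 (λ h → con (inv 4) :* (h :+ con 1ℚ :* h) := con (inv 2) :* h) refl h ⟩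
  inv 2 * h                                        ≡⟨ inv-* 2 (2 ℕ.^ (3 ℕ.+ i)) ⟨
  inv (2 ℕ.^ (4 ℕ.+ i))                            ∎
  where
  open ≤-Reasoning
  y = D i μ - β (suc i) * shift (D i) μ
  h = inv (2 ℕ.^ (3 ℕ.+ i))

inv-2^-antimono : ∀ {m n} → m ℕ.≤ n → inv (2 ℕ.^ n) ≤ inv (2 ℕ.^ m)
inv-2^-antimono {m} m≤n = inv-antimono-≤ {{ℕ.m^n≢0 2 m}} (ℕ.^-monoʳ-≤ 2 m≤n)

∣A∣≤ : ∀ k μ → ∣ A k μ ∣ ≤ inv (2 ℕ.^ k)
∣A∣≤ zero    μ = ∣δ∣≤1 μ
∣A∣≤ (suc i) μ = begin
  ∣ D i μ - shift (D i) μ ∣ ≤⟨ ∣p-q∣≤ (∣D∣≤ i μ) (∣shift∣≤ (0≤inv (2 ℕ.^ (3 ℕ.+ i))) (∣D∣≤ i) μ) ⟩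
  h + h                     ≡⟨ inv-2^-double (2 ℕ.+ i) ⟩
  inv (2 ℕ.^ (2 ℕ.+ i))     ≤⟨ inv-2^-antimono (ℕ.n≤1+n (suc i)) ⟩
  inv (2 ℕ.^ suc i)         ∎
  where
  open ≤-Reasoning
  h = inv (2 ℕ.^ (3 ℕ.+ i))

0≤σ : ∀ j t → 0ℚ ≤ σ j t
0≤σ j t = *-nonNeg (0≤ℕ→ℚ ((2 ℕ.* j) ! ℕ.* t !)) (0≤inv ((2 ℕ.* j ℕ.+ t) !))

-- As the reciprocal of a binomial coefficient: (2j)! t! divides (2j+t)!.
σ≤1 : ∀ j t → σ j t ≤ 1ℚ
σ≤1 j t = fraction≤1 {{ℕ._!≢0 (2 ℕ.* j ℕ.+ t)}} (∣⇒≤ {{ℕ._!≢0 (2 ℕ.* j ℕ.+ t)}}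
  (subst (λ s → (2 ℕ.* j) ! ℕ.* s ! ∣ (2 ℕ.* j ℕ.+ t) !) (ℕ.m+n∸m≡n (2 ℕ.* j) t) (k![n∸k]!∣n! (ℕ.m≤m+n (2 ℕ.* j) t))))

0≤e : ∀ N k → 0ℚ ≤ e N k
0≤e N k = *-nonNeg (*-nonNeg (*-nonNeg (0≤inv 4) (0≤inv (odd k))) (0≤inv (suc (N ℕ.+ k)))) (0≤σ k (N ℕ.∸ k))

e≤ : ∀ N k → e N k ≤ inv 4 * inv (suc N)
e≤ N k = begin
  inv 4 * inv (odd k) * inv (suc (N ℕ.+ k)) * σ k (N ℕ.∸ k)
    ≤⟨ *-mono-≤-nonNeg {q = inv 4 * 1ℚ * inv (suc N)} (*-nonNeg (0≤inv 4) (0≤inv (suc N))) (0≤σ k (N ℕ.∸ k))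
         (*-mono-≤-nonNeg {q = inv 4 * 1ℚ} (0≤inv 4) (0≤inv (suc (N ℕ.+ k))) (*-monoˡ-≤-nonNeg (inv 4) (inv≤1 (odd k)))
           (inv-antimono-≤ (s≤s (ℕ.m≤m+n N k))))
         (σ≤1 k (N ℕ.∸ k)) ⟩
  inv 4 * 1ℚ * inv (suc N) * 1ℚ
    ≡⟨ *-identityʳ (inv 4 * inv (suc N)) ⟩
  inv 4 * inv (suc N) ∎
  where open ≤-Reasoning

-- The right side is c times the exact value of Σ_{k<n} 2⁻ᵏ, a form that the induction reproduces.
∑-geometric : ∀ {f c} → (∀ k → ∣ f k ∣ ≤ c * inv (2 ℕ.^ k)) → ∀ n → ∣ ∑ n f ∣ ≤ c * (2ℚ - 2ℚ * inv (2 ℕ.^ n))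
∑-geometric {f} {c} bound zero    = ≤-reflexive (sym (*-zeroʳ c))
∑-geometric {f} {c} bound (suc n) = begin
  ∣ ∑ n f + f n ∣                    ≤⟨ ∣p+q∣≤∣p∣+∣q∣ (∑ n f) (f n) ⟩
  ∣ ∑ n f ∣ + ∣ f n ∣                ≤⟨ +-mono-≤ (∑-geometric {c = c} bound n) (bound n) ⟩
  c * (2ℚ - 2ℚ * h) + c * h          ≡⟨ solve 2 (λ c h → c :* (con 2ℚ :- con 2ℚ :* h) :+ c :* h := c :* (con 2ℚ :- con 2ℚ :* (con (inv 2) :* h))) refl c h ⟩
  c * (2ℚ - 2ℚ * (inv 2 * h))        ≡⟨ cong (λ z → c * (2ℚ - 2ℚ * z)) (inv-* 2 (2 ℕ.^ n)) ⟨
  c * (2ℚ - 2ℚ * inv (2 ℕ.^ suc n))  ∎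
  where
  open ≤-Reasoning
  h = inv (2 ℕ.^ n)

-- Each weight `e N k` is at most 1/(4(N+1)) and Σ 2⁻ᵏ stays below 2, so even half of the stated
-- bound would hold.
∣E∣≤ : ∀ N μ → ∣ E N μ ∣ ≤ inv (suc N)
∣E∣≤ N μ = begin
  ∣ E N μ ∣                             ≤⟨ ∑-geometric {c = inv 4 * r} (λ k → ∣p∣*-mono (0≤e N k) (e≤ N k) (∣A∣≤ k μ)) (suc N) ⟩
  inv 4 * r * (2ℚ - 2ℚ * h)             ≡⟨ solve 2 (λ r h → con (inv 4) :* r :* (con 2ℚ :- con 2ℚ :* h) := r :- (con (inv 2) :* (r :+ r :* h))) refl r h ⟩
  r - inv 2 * (r + r * h)               ≤⟨ +-monoʳ-≤ r (neg-antimono-≤ (*-nonNeg (0≤inv 2) (+-mono-≤ (0≤inv (suc N)) (*-nonNeg (0≤inv (suc N)) (0≤inv (2 ℕ.^ suc N)))))) ⟩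
  r + 0ℚ                                ≡⟨ +-identityʳ r ⟩
  r                                     ∎
  where
  open ≤-Reasoning
  r = inv (suc N)
  h = inv (2 ℕ.^ suc N)

n<2^n : ∀ n → n ℕ.< 2 ℕ.^ n
n<2^n zero    = s≤s z≤n
n<2^n (suc n) = ℕ.+-mono-≤ (ℕ.m^n>0 2 n) (ℕ.≤-trans (n<2^n n) (ℕ.m≤m+n (2 ℕ.^ n) 0))

-- The decay is geometric; it is weakened through N < 2ᴺ to the shape shared by the other two
-- errors.
∣V∣≤ : ∀ N μ → ∣ V N μ ∣ ≤ inv (suc N)
∣V∣≤ N μ = begin
  ∣ - (2ℚ * x * D N μ) ∣      ≡⟨ ∣-p∣≡∣p∣ (2ℚ * x * D N μ) ⟩
  ∣ 2ℚ * x * D N μ ∣          ≤⟨ ∣p∣*-mono (*-nonNeg (0≤ℕ→ℚ 2) 0≤x) (*-monoˡ-≤-nonNeg 2ℚ x≤1) (∣D∣≤ N μ) ⟩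
  2ℚ * 1ℚ * h                 ≡⟨ solve 1 (λ h → con (2ℚ * 1ℚ) :* h := h :+ h) refl h ⟩
  h + h                       ≡⟨ inv-2^-double (2 ℕ.+ N) ⟩
  inv (2 ℕ.^ (2 ℕ.+ N))       ≤⟨ inv-2^-antimono (ℕ.m≤n+m N 2) ⟩
  inv (2 ℕ.^ N)               ≤⟨ inv-antimono-≤ (n<2^n N) ⟩
  inv (suc N)                 ∎
  where
  open ≤-Reasoning
  h = inv (2 ℕ.^ (3 ℕ.+ N))
  x = ℕ→ℚ (suc N) * inv (odd N)
  0≤x : 0ℚ ≤ x
  0≤x = *-nonNeg (0≤ℕ→ℚ (suc N)) (0≤inv (odd N))
  x≤1 : x ≤ 1ℚ
  x≤1 = fraction≤1 {{odd≢0 N}} (subst (suc N ℕ.≤_) (sym (odd≡suc N)) (s≤s (ℕ.m≤m+n N (N ℕ.+ 0))))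

-- Comparison of the odd sum with the zeta partial sums.

βpow≡inv : ∀ k μ → βpow k μ ≡ inv (odd k ℕ.^ (2 ℕ.* μ ℕ.+ 2))
βpow≡inv k zero    = sym (inv-odd² k)
βpow≡inv k (suc μ) = begin
  β k * βpow k μ                          ≡⟨ cong (β k *_) (βpow≡inv k μ) ⟩
  β k * inv (odd k ℕ.^ (2 ℕ.* μ ℕ.+ 2))   ≡⟨ inv-odd-^ k (2 ℕ.* μ ℕ.+ 2) ⟨
  inv (odd k ℕ.^ (2 ℕ.+ (2 ℕ.* μ ℕ.+ 2))) ≡⟨ cong (λ n → inv (odd k ℕ.^ (n ℕ.+ 2))) (ℕ.*-suc 2 μ) ⟨
  inv (odd k ℕ.^ (2 ℕ.* suc μ ℕ.+ 2))     ∎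
  where open ≡-Reasoning

sumTo-odd-even : ∀ N f → sumTo (suc (2 ℕ.* N)) f ≡ f 1 + sumTo N (f ∘ odd) + sumTo N (λ n → f (2 ℕ.* n))
sumTo-odd-even zero    f = solve 1 (λ x → con 0ℚ :+ x := x :+ con 0ℚ :+ con 0ℚ) refl (f 1)
sumTo-odd-even (suc N) f = begin
  sumTo (suc (2 ℕ.* suc N)) f
    ≡⟨ cong (λ n → sumTo n f + f (2 ℕ.* suc N) + f (suc (2 ℕ.* suc N))) (cong (ℕ._∸ 1) (ℕ.*-suc 2 N)) ⟩
  sumTo (suc (2 ℕ.* N)) f + y + f (suc (2 ℕ.* suc N))
    ≡⟨ cong₂ (λ u n → u + y + f n) (sumTo-odd-even N f) (sym (odd≡suc (suc N))) ⟩
  f 1 + s + t + y + x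
    ≡⟨ solve 5 (λ a s t x y → a :+ s :+ t :+ y :+ x := a :+ (s :+ x) :+ (t :+ y)) refl (f 1) s t x y ⟩
  f 1 + (s + x) + (t + y) ∎
  where
  open ≡-Reasoning
  s = sumTo N (f ∘ odd)
  t = sumTo N (λ n → f (2 ℕ.* n))
  x = f (odd (suc N))
  y = f (2 ℕ.* suc N)

sumTo-block : ∀ {f c} N m → (∀ k → 0ℚ ≤ f k) → (∀ k → N ℕ.< k → f k ≤ c) →
              ∣ sumTo (m ℕ.+ N) f - sumTo N f ∣ ≤ ℕ→ℚ m * c
sumTo-block {f} {c} N m 0≤f f≤c = go m
  where
  open ≤-Reasoning
  s = sumTo N f
  go : ∀ m → ∣ sumTo (m ℕ.+ N) f - s ∣ ≤ ℕ→ℚ m * c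
  go zero = ≤-reflexive (trans (cong ∣_∣ (+-inverseʳ s)) (sym (*-zeroˡ c)))
  go (suc m) = begin
    ∣ sumTo (m ℕ.+ N) f + y - s ∣   ≡⟨ cong ∣_∣ (solve 3 (λ u y s → u :+ y :- s := u :- s :+ y) refl (sumTo (m ℕ.+ N) f) y s) ⟩
    ∣ sumTo (m ℕ.+ N) f - s + y ∣   ≤⟨ ∣p+q∣≤∣p∣+∣q∣ (sumTo (m ℕ.+ N) f - s) y ⟩
    ∣ sumTo (m ℕ.+ N) f - s ∣ + ∣ y ∣ ≤⟨ +-mono-≤ (go m) (≤-trans (≤-reflexive (0≤p⇒∣p∣≡p (0≤f (suc (m ℕ.+ N))))) (f≤c (suc (m ℕ.+ N)) (s≤s (ℕ.m≤n+m N m)))) ⟩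
    ℕ→ℚ m * c + c                   ≡⟨ solve 2 (λ m c → m :* c :+ c := (con 1ℚ :+ m) :* c) refl (ℕ→ℚ m) c ⟩
    (1ℚ + ℕ→ℚ m) * c                ≡⟨ cong (_* c) (ℕ→ℚ-+ 1 m) ⟨
    ℕ→ℚ (suc m) * c                 ∎
    where y = f (suc (m ℕ.+ N))

^-distribʳ-* : ∀ o m n → (m ℕ.* n) ℕ.^ o ≡ m ℕ.^ o ℕ.* n ℕ.^ o
^-distribʳ-* zero    m n = refl
^-distribʳ-* (suc o) m n = trans (cong (m ℕ.* n ℕ.*_) (^-distribʳ-* o m n))
  (S.solve 4 (λ m n p q → m S.:* n S.:* (p S.:* q) S.:= m S.:* p S.:* (n S.:* q)) refl m n (m ℕ.^ o) (n ℕ.^ o))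

module _ (μ : ℕ) where

  private
    s = 2 ℕ.* μ ℕ.+ 2
    f : ℕ → ℚ
    f n = inv (n ℕ.^ s)

  inv-even-^ : ∀ n → inv ((2 ℕ.* n) ℕ.^ s) ≡ inv (4 ℕ.^ (μ ℕ.+ 1)) * inv (n ℕ.^ s)
  inv-even-^ n = begin
    inv ((2 ℕ.* n) ℕ.^ s)            ≡⟨ cong inv (^-distribʳ-* s 2 n) ⟩
    inv (2 ℕ.^ s ℕ.* n ℕ.^ s)        ≡⟨ inv-* (2 ℕ.^ s) (n ℕ.^ s) ⟩
    inv (2 ℕ.^ s) * inv (n ℕ.^ s)    ≡⟨ cong (λ m → inv m * inv (n ℕ.^ s)) (trans (cong (2 ℕ.^_) (sym (ℕ.*-distribˡ-+ 2 μ 1))) (sym (ℕ.^-*-assoc 2 2 (μ ℕ.+ 1)))) ⟩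
    inv (4 ℕ.^ (μ ℕ.+ 1)) * inv (n ℕ.^ s) ∎
    where open ≡-Reasoning

  -- The odd sum consists of the odd-indexed terms n⁻ˢ with n ≤ 2N + 1; the even-indexed ones make
  -- up exactly 4^(-μ-1) times the zeta partial sum at N. Adding them completes the sum up to 2N +
  -- 1.
  oddSum-lhsPartial : ∀ N → oddSum μ N - lhsPartial μ N ≡ sumTo (suc N ℕ.+ N) f - sumTo N f
  oddSum-lhsPartial N = begin
    1ℚ + sumTo N (λ n → βpow n μ) - (1ℚ - q) * z
      ≡⟨ cong₂ (λ u v → u + v - (1ℚ - q) * z) (sym (cong inv (ℕ.^-zeroˡ s))) (sumTo-cong N (λ n → βpow≡inv n μ)) ⟩
    f 1 + sumTo N (f ∘ odd) - (1ℚ - q) * z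
      ≡⟨ solve 3 (λ a q z → a :- (con 1ℚ :- q) :* z := a :+ q :* z :- z) refl (f 1 + sumTo N (f ∘ odd)) q z ⟩
    f 1 + sumTo N (f ∘ odd) + q * z - z
      ≡⟨ cong (λ u → f 1 + sumTo N (f ∘ odd) + u - z) (trans (sumTo-cong N inv-even-^) (sumTo-*ˡ N q f)) ⟨
    f 1 + sumTo N (f ∘ odd) + sumTo N (λ n → f (2 ℕ.* n)) - z
      ≡⟨ cong (_- z) (sumTo-odd-even N f) ⟨
    sumTo (suc (2 ℕ.* N)) f - z
      ≡⟨ cong (λ m → sumTo (suc (N ℕ.+ m)) f - z) (ℕ.+-identityʳ N) ⟩
    sumTo (suc N ℕ.+ N) f - z ∎
    where
    open ≡-Reasoning
    q = inv (4 ℕ.^ (μ ℕ.+ 1))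
    z = zetaPartial s N

  -- The block N < n ≤ 2N + 1 has N + 1 terms, each at most 1/(N+1)² because s ≥ 2.
  ∣oddSum-lhsPartial∣≤ : ∀ N → ∣ oddSum μ N - lhsPartial μ N ∣ ≤ inv (suc N)
  ∣oddSum-lhsPartial∣≤ N = begin
    ∣ oddSum μ N - lhsPartial μ N ∣              ≡⟨ cong ∣_∣ (oddSum-lhsPartial N) ⟩
    ∣ sumTo (suc N ℕ.+ N) f - sumTo N f ∣        ≤⟨ sumTo-block N (suc N) (λ k → 0≤inv (k ℕ.^ s)) small ⟩
    ℕ→ℚ (suc N) * (inv (suc N) * inv (suc N))    ≡⟨ *-assoc (ℕ→ℚ (suc N)) (inv (suc N)) (inv (suc N)) ⟨
    ℕ→ℚ (suc N) * inv (suc N) * inv (suc N)      ≡⟨ cong (_* inv (suc N)) (inv-inverseʳ (suc N)) ⟩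
    1ℚ * inv (suc N)                             ≡⟨ *-identityˡ (inv (suc N)) ⟩
    inv (suc N)                                  ∎
    where
    open ≤-Reasoning
    small : ∀ k → N ℕ.< k → f k ≤ inv (suc N) * inv (suc N)
    small k N<k = begin
      inv (k ℕ.^ s)               ≤⟨ inv-antimono-≤ {{ℕ.m^n≢0 (suc N) 2}} (ℕ.≤-trans (ℕ.^-monoˡ-≤ 2 N<k)
                                      (ℕ.^-monoʳ-≤ k {{ℕ.>-nonZero (ℕ.≤-trans (s≤s z≤n) N<k)}} (ℕ.m≤n+m 2 (2 ℕ.* μ)))) ⟩
      inv (suc N ℕ.^ 2)           ≡⟨ trans (cong (λ m → inv (suc N ℕ.* m)) (ℕ.*-identityʳ (suc N))) (inv-* (suc N) (suc N)) ⟩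
      inv (suc N) * inv (suc N)   ∎

-- Passage to the limit.

∣lhs-rhs∣≤ : ∀ μ N → ∣ lhsPartial μ N - rhsPartial μ N ∣ ≤ inv (suc N) + inv (suc N) + inv (suc N)
∣lhs-rhs∣≤ μ N = begin
  ∣ L - R ∣                     ≡⟨ cong ∣_∣ (solve 3 (λ l r o → l :- r := o :- r :- (o :- l)) refl L R O) ⟩
  ∣ O - R - (O - L) ∣           ≡⟨ cong (λ z → ∣ z - (O - L) ∣) (finite-identity μ N) ⟩
  ∣ V N μ - E N μ - (O - L) ∣   ≤⟨ ∣p-q∣≤ (∣p-q∣≤ (∣V∣≤ N μ) (∣E∣≤ N μ)) (∣oddSum-lhsPartial∣≤ μ N) ⟩
  inv (suc N) + inv (suc N) + inv (suc N) ∎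
  where
  open ≤-Reasoning
  L = lhsPartial μ N
  R = rhsPartial μ N
  O = oddSum μ N

0<inv : ∀ n .{{_ : NonZero n}} → 0ℚ < inv n
0<inv (suc n) = toℚᵘ-cancel-< (begin-strict
  toℚᵘ 0ℚ             <⟨ *<* (ℤ.+<+ (s≤s z≤n)) ⟩
  mkℚᵘ (+ 1) n        ≃⟨ toℚᵘ-/ (+ 1) n ⟨
  toℚᵘ (inv (suc n))  ∎)
  where open ℚᵘ.≤-Reasoning

archimedean : ∀ ε → 0ℚ < ε → ∃ λ d → inv (suc d) ≤ ε
archimedean (mkℚ (+ zero)    d c) (*<* (ℤ.+<+ ()))
archimedean (mkℚ ℤ.-[1+ n ]  d c) (*<* ())
-- The denominator of ε serves as witness, because the numerator is at least 1; `mkℚ` stores the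
-- denominator minus one.
archimedean ε@(mkℚ (+ suc p) d c) _ = d , toℚᵘ-cancel-≤ (begin
  toℚᵘ (inv (suc d))  ≃⟨ toℚᵘ-/ (+ 1) d ⟩
  mkℚᵘ (+ 1) d        ≤⟨ *≤* (ℤ.*-monoʳ-≤-nonNeg (+ suc d) {+ 1} {+ suc p} (ℤ.+≤+ (s≤s z≤n))) ⟩
  toℚᵘ ε              ∎)
  where open ℚᵘ.≤-Reasoning

theorem6p1 : (μ : ℕ) → (ε : ℚ) → 0ℚ < ε →
    Σ ℕ (λ N → (n : ℕ) → n ≥ N → ∣ lhsPartial μ n - rhsPartial μ n ∣ < ε)
theorem6p1 μ ε 0<ε with archimedean ε 0<ε
-- Each of the three errors is at most a quarter of 1/(d+1); the fourth quarter is the slack that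
-- makes the inequality strict.
... | d , inv≤ε = 4 ℕ.* suc d , λ n n≥N → begin-strict
  ∣ lhsPartial μ n - rhsPartial μ n ∣      ≤⟨ ∣lhs-rhs∣≤ μ n ⟩
  inv (suc n) + inv (suc n) + inv (suc n)  ≤⟨ +-mono-≤ (+-mono-≤ (≤r n≥N) (≤r n≥N)) (≤r n≥N) ⟩
  r + r + r                                ≡⟨ +-identityʳ (r + r + r) ⟨
  r + r + r + 0ℚ                           <⟨ +-monoʳ-< (r + r + r) (0<inv (4 ℕ.* suc d)) ⟩
  r + r + r + r                            ≡⟨ cong (λ z → z + z + z + z) (inv-* 4 (suc d)) ⟩
  q + q + q + q                            ≡⟨ solve 1 (λ x → con (inv 4) :* x :+ con (inv 4) :* x :+ con (inv 4) :* x :+ con (inv 4) :* x := x) refl (inv (suc d)) ⟩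
  inv (suc d)                              ≤⟨ inv≤ε ⟩
  ε                                        ∎
  where
  open ≤-Reasoning
  r = inv (4 ℕ.* suc d)
  q = inv 4 * inv (suc d)
  ≤r : ∀ {n} → n ≥ 4 ℕ.* suc d → inv (suc n) ≤ r
  ≤r n≥N = inv-antimono-≤ (ℕ.m≤n⇒m≤1+n n≥N)
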